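{- Let $\ell \geq 4$ be even, let $n \equiv 1 \pmod{2\ell}$ and let $N=(n-1)/(2\ell)$. Then \[ \mu(\ell,n) \geq \mu'(\ell,n) \geq \frac{N}{a\ell+b}-1, \] where $(a,b)=(4,-2)$ if $\ell \equiv 0 \pmod 4$, and $(a,b)=(24,-18)$ if $\ell \equiv 2 \pmod 4$.
   Context: An $\ell$-cycle system of a graph $\Gamma$ is a set of $\ell$-cycles whose edge sets partition the edge set of $\Gamma$; an $\ell$-cycle system of order $n$ is an $\ell$-cycle system of the complete graph $K_n$. Two $\ell$-cycle systems $\mathcal F,\mathcal F'$ of the same graph are orthogonal if every cycle $C\in\mathcal F$ and every cycle $C'\in\mathcal F'$ share at most one edge; a set of pairwise orthogonal systems is called mutually orthogonal. With the vertex set of $K_n$ identified with $\mathbb{Z}_n$, an $\ell$-cycle system $\mathcal F$ is cyclic if for every cycle $C=(c_0,\dots,c_{\ell-1})\in\mathcal F$ and every $g\in\mathbb{Z}_n$, the cycle $C+g=(c_0+g,\dots,c_{\ell-1}+g)$ is also in $\mathcal F$. $\mu(\ell,n)$ denotes the maximum size of a set of mutually orthogonal $\ell$-cycle systems of order $n$, and $\mu'(\ell,n)$ the maximum size of a set of mutually orthogonal cyclic $\ell$-cycle systems of order $n$. -}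

module Defs where

open import Data.Nat using (ℕ; zero; suc; _+_; _%_)
open import Data.Nat.DivMod using (m%n<n)
open import Data.Fin using (Fin; toℕ; fromℕ<)
open import Data.List using (List; length; lookup)
open import Data.Product using (Σ; _×_; _,_)
open import Data.Sum using (_⊎_)
open import Relation.Binary.PropositionalEquality using (_≡_; _≢_)
open import Function.Bundles using (_⇔_)
open import Function.Definitions using (Injective)

-- Vertex set of K_n is Z_n, represented by Fin n.
-- Addition in Z_n.
_⊕_ : ∀ {n} → Fin n → Fin n → Fin n
_⊕_ {suc k} x y = fromℕ< (m%n<n (toℕ x + toℕ y) (suc k))

nextPos : ∀ {ℓ} → Fin ℓ → Fin ℓ
nextPos {suc k} i = fromℕ< (m%n<n (suc (toℕ i)) (suc k))

record Cycle (ℓ n : ℕ) : Set where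
  constructor cycle
  field
    vtx      : Fin ℓ → Fin n
    distinct : Injective _≡_ _≡_ vtx
open Cycle public

EdgeOfSeq : ∀ {ℓ n} → (Fin ℓ → Fin n) → Fin n → Fin n → Set
EdgeOfSeq {ℓ} c x y = Σ (Fin ℓ) λ i →
  (c i ≡ x × c (nextPos i) ≡ y) ⊎ (c i ≡ y × c (nextPos i) ≡ x)

EdgeOf : ∀ {ℓ n} → Cycle ℓ n → Fin n → Fin n → Set
EdgeOf C = EdgeOfSeq (vtx C)

EdgeOfTranslate : ∀ {ℓ n} → Cycle ℓ n → Fin n → Fin n → Fin n → Set
EdgeOfTranslate C g = EdgeOfSeq (λ i → vtx C i ⊕ g)

record CycleSystem (ℓ n : ℕ) : Set where
  field
    cycles : List (Cycle ℓ n)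
    covers : (x y : Fin n) → x ≢ y →
             Σ (Fin (length cycles)) λ k → EdgeOf (lookup cycles k) x y
    unique : (x y : Fin n) (k k′ : Fin (length cycles)) →
             EdgeOf (lookup cycles k) x y → EdgeOf (lookup cycles k′) x y → k ≡ k′
open CycleSystem public

-- cyclic: for every C ∈ F and g ∈ Z_n, the cycle C + g is in F
-- (cycles being identified with their edge sets, i.e. as subgraphs)
IsCyclic : ∀ {ℓ n} → CycleSystem ℓ n → Set
IsCyclic {n = n} F = (k : Fin (length (cycles F))) (g : Fin n) →
  Σ (Fin (length (cycles F))) λ k′ → (x y : Fin n) →
    EdgeOf (lookup (cycles F) k′) x y ⇔ EdgeOfTranslate (lookup (cycles F) k) g x y

SameEdge : ∀ {n} → Fin n → Fin n → Fin n → Fin n → Set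
SameEdge x y u v = (x ≡ u × y ≡ v) ⊎ (x ≡ v × y ≡ u)

Orthogonal : ∀ {ℓ n} → CycleSystem ℓ n → CycleSystem ℓ n → Set
Orthogonal {n = n} F F′ =
  (k : Fin (length (cycles F))) (k′ : Fin (length (cycles F′))) (x y u v : Fin n) →
  EdgeOf (lookup (cycles F) k) x y → EdgeOf (lookup (cycles F′) k′) x y →
  EdgeOf (lookup (cycles F) k) u v → EdgeOf (lookup (cycles F′) k′) u v →
  SameEdge x y u v

MOFamily : (ℓ n m : ℕ) → Set
MOFamily ℓ n m = Σ (Fin m → CycleSystem ℓ n) λ F →
  (i j : Fin m) → i ≢ j → Orthogonal (F i) (F j)

MOCyclicFamily : (ℓ n m : ℕ) → Set
MOCyclicFamily ℓ n m = Σ (Fin m → CycleSystem ℓ n) λ F →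
  ((i : Fin m) → IsCyclic (F i)) × ((i j : Fin m) → i ≢ j → Orthogonal (F i) (F j))

{-# OPTIONS --safe #-}

-- Write n = 1 + 2ℓN and split {1, …, ℓN}, up to d ↦ n − d, into ℓ classes cN + 1 + [0, N).
-- For a parameter r, the i-th base cycle takes from the class at position j the difference with
-- offset (i + r w_j) mod N, where the weights w_j pair up the positions; the two edges of a pair
-- have a constant (signed) sum, so the cycle closes up without any wrap-around condition.
-- Suppose that cycles for r ≠ r′ share two edges. If their weights are a ≠ b, subtracting the two
-- congruences gives (r − r′)(a − b) ≡ 0 mod N, impossible for small r, r′. If the weights are
-- equal, the differences agree for trivial reasons, but the two edges are separated in the cycle
-- by edges of other weights, and their relative position depends on r by the same congruence.
module Submission where

open import Defs
open import Data.Nat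
open import Data.Nat.Properties
open import Data.Nat.DivMod
open import Data.Nat.Divisibility using (_∣_; divides; m%n≡0⇒n∣m)
open import Data.Nat.Tactic.RingSolver using (solve-∀)
open import Data.Fin as Fin using (Fin; zero; suc; toℕ; fromℕ<; cast; combine; remQuot)
open import Data.Fin.Patterns using (0F; 1F; 2F; 3F)
open import Data.Fin.Properties using (toℕ<n; toℕ-injective; toℕ-fromℕ<; cast-involutive; toℕ-combine; remQuot-combine; combine-remQuot; combine-surjective)
open import Data.List using (List; tabulate; length; lookup)
open import Data.List.Properties using (length-tabulate; lookup-tabulate)
open import Data.Product using (Σ; _×_; _,_; proj₁; proj₂; uncurry)
open import Data.Sum as Sum using (_⊎_; inj₁; inj₂)
open import Data.Empty using (⊥; ⊥-elim)
open import Function using (_∘_; id)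
open import Function.Bundles using (_⇔_; mk⇔)
open import Relation.Nullary using (contradiction; yes; no)
open import Relation.Binary.Definitions using (tri<; tri≈; tri>)
open import Relation.Binary.PropositionalEquality

-- Pairing the weights cancels the offsets, but the class numbers (the multiples of N) must cancel
-- too: a cycle closes only if the signed sum of its ℓ class numbers is zero. Classes that increase
-- along the cycle with alternating signs make the vertices distinct whatever the offsets are, by
-- comparing blocks of length N; but 0 - 1 + 2 - 3 ... is not zero. So one class is taken out of
-- order and put on the last edge, where it balances the others. The vertices of a base cycle are
-- thus honest integers in [0, n), and reduction modulo n enters only with translation. For fixed r,
-- the offset i + r w takes every value modulo N exactly once as i varies, whatever the weight w; so
-- each difference up to sign arises exactly once, and its n translates are all the edges with that
-- difference. Both ways of sharing two edges lead to one equation σ a + τ b = σ b + τ a with a ≠ b,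
-- where σ, τ are the offset functions for r, r′. As r, r′ < m and a, b < ℓ, the number (r - r′)(a -
-- b) is nonzero and smaller than m ℓ ≤ N in absolute value.

-- Congruences modulo n, without subtraction.

module _ (n : ℕ) .{{_ : NonZero n}} where

  %-cong-+ : ∀ {a b c d} → a % n ≡ b % n → c % n ≡ d % n → (a + c) % n ≡ (b + d) % n
  %-cong-+ {a} {b} {c} {d} p q = begin
    (a + c) % n          ≡⟨ %-distribˡ-+ a c n ⟩
    (a % n + c % n) % n  ≡⟨ cong₂ (λ u v → (u + v) % n) p q ⟩
    (b % n + d % n) % n  ≡⟨ %-distribˡ-+ b d n ⟨
    (b + d) % n          ∎ where open ≡-Reasoning

  -- `g * pred n` is congruent to -g and stands in for subtraction in ℕ.
  [m+g+pn-g]%n : ∀ a g → (a + g + g * pred n) % n ≡ a % n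
  [m+g+pn-g]%n a g = begin
    (a + g + g * pred n) % n    ≡⟨ cong (_% n) (regroup a g (pred n)) ⟩
    (a + g * suc (pred n)) % n  ≡⟨ cong (λ k → (a + g * k) % n) (suc-pred n) ⟩
    (a + g * n) % n             ≡⟨ [m+kn]%n≡m%n a g n ⟩
    a % n                       ∎
    where
    open ≡-Reasoning
    regroup : ∀ a g k → a + g + g * k ≡ a + g * suc k
    regroup = solve-∀

  %-cancelʳ-+ : ∀ a b g → (a + g) % n ≡ (b + g) % n → a % n ≡ b % n
  %-cancelʳ-+ a b g p = begin
    a % n                     ≡⟨ [m+g+pn-g]%n a g ⟨
    (a + g + g * pred n) % n  ≡⟨ %-cong-+ {a + g} {b + g} p refl ⟩
    (b + g + g * pred n) % n  ≡⟨ [m+g+pn-g]%n b g ⟩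
    b % n                     ∎ where open ≡-Reasoning

  %-injective : ∀ a b → a < n → b < n → a % n ≡ b % n → a ≡ b
  %-injective a b a<n b<n p = trans (sym (m<n⇒m%n≡m a<n)) (trans p (m<n⇒m%n≡m b<n))

  shift-solve : ∀ c {t} → t < n → Σ (Fin n) λ i → (toℕ i + c) % n ≡ t
  shift-solve c {t} t<n = fromℕ< (m%n<n s n) , (begin
    (toℕ (fromℕ< (m%n<n s n)) + c) % n ≡⟨ cong (λ k → (k + c) % n) (toℕ-fromℕ< (m%n<n s n)) ⟩
    (s % n + c) % n                    ≡⟨ %-cong-+ {s % n} {s} (m%n%n≡m%n s n) refl ⟩
    (s + c) % n                        ≡⟨ cong (_% n) (regroup t c (pred n)) ⟩
    (t + c + c * pred n) % n           ≡⟨ [m+g+pn-g]%n t c ⟩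
    t % n                              ≡⟨ m<n⇒m%n≡m t<n ⟩
    t                                  ∎)
    where
    open ≡-Reasoning
    s = t + c * pred n
    regroup : ∀ t c k → t + c * k + c ≡ t + c + c * k
    regroup = solve-∀

  quotRem-unique : ∀ {c c′ t t′} → t < n → t′ < n → c * n + t ≡ c′ * n + t′ → c ≡ c′ × t ≡ t′
  quotRem-unique {c} {c′} {t} {t′} t<n t′<n p = *-cancelʳ-≡ c c′ n cn≡c′n , t≡t′
    where
    rem : ∀ c {t} → t < n → (c * n + t) % n ≡ t
    rem c {t} t<n = trans (cong (_% n) (+-comm (c * n) t)) (trans ([m+kn]%n≡m%n t c n) (m<n⇒m%n≡m t<n))
    t≡t′ = trans (sym (rem c t<n)) (trans (cong (_% n) p) (rem c′ t′<n))
    cn≡c′n : c * n ≡ c′ * n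
    cn≡c′n = +-cancelʳ-≡ t′ (c * n) (c′ * n) (trans (cong (c * n +_) (sym t≡t′)) p)

-- Offsets and the congruence that separates two parameters.

module Shifts (N : ℕ) .{{_ : NonZero N}} where

  shift : ℕ → ℕ → ℕ → ℕ
  shift r i k = (i + r * k) % N

  shift< : ∀ r i k → shift r i k < N
  shift< r i k = m%n<n (i + r * k) N

  shift-injective : ∀ r k {i i′} → i < N → i′ < N → shift r i k ≡ shift r i′ k → i ≡ i′
  shift-injective r k {i} {i′} i<N i′<N p = %-injective N i i′ i<N i′<N (%-cancelʳ-+ N i i′ (r * k) p)

  private
    -- (r − r′)(a − b) ≡ 0 mod N, with the terms moved so that no subtraction occurs.
    Crossed : (r r′ i i′ a b : ℕ) → Set
    Crossed r r′ i i′ a b = (i + r * a + (i′ + r′ * b)) % N ≡ (i + r * b + (i′ + r′ * a)) % N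

    crossed : ∀ r r′ i i′ a b →
      shift r i a + shift r′ i′ b ≡ shift r i b + shift r′ i′ a → Crossed r r′ i i′ a b
    crossed r r′ i i′ a b p = begin
      (i + r * a + (i′ + r′ * b)) % N          ≡⟨ %-distribˡ-+ (i + r * a) (i′ + r′ * b) N ⟩
      (shift r i a + shift r′ i′ b) % N        ≡⟨ cong (_% N) p ⟩
      (shift r i b + shift r′ i′ a) % N        ≡⟨ %-distribˡ-+ (i + r * b) (i′ + r′ * a) N ⟨
      (i + r * b + (i′ + r′ * a)) % N          ∎ where open ≡-Reasoning

    swap : ∀ r r′ i i′ a b → Crossed r r′ i i′ a b → Crossed r′ r i′ i b a
    swap r r′ i i′ a b p = begin
      (i′ + r′ * b + (i + r * a)) % N  ≡⟨ cong (_% N) (+-comm (i′ + r′ * b) (i + r * a)) ⟩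
      (i + r * a + (i′ + r′ * b)) % N  ≡⟨ p ⟩
      (i + r * b + (i′ + r′ * a)) % N  ≡⟨ cong (_% N) (+-comm (i + r * b) (i′ + r′ * a)) ⟩
      (i′ + r′ * a + (i + r * b)) % N  ∎ where open ≡-Reasoning

    -- With r′ = r + (s + 1) and b = a + (u + 1), the two sides differ by exactly (s + 1)(u + 1).
    -- This is positive and at most r′ b < m ℓ ≤ N, so it cannot vanish modulo N.
    crossed-< : ∀ {ℓ m} r r′ i i′ a b → r′ < m → b < ℓ → m * ℓ ≤ N → r < r′ → a < b →
                Crossed r r′ i i′ a b → ⊥
    crossed-< {ℓ} {m} r r′ i i′ a b r′<m b<ℓ mℓ≤N r<r′ a<b p
      with s , refl ← m≤n⇒∃[o]m+o≡n r<r′ | u , refl ← m≤n⇒∃[o]m+o≡n a<b = 1+n≢0 su≡0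
      where
      X = i + r * b + (i′ + r′ * a)
      expand : ∀ r s a u i i′ →
        i + r * a + (i′ + (suc r + s) * (suc a + u)) ≡
        suc s * suc u + (i + r * (suc a + u) + (i′ + (suc r + s) * a))
      expand = solve-∀
      su<N : suc s * suc u < N
      su<N = <-≤-trans (*-mono-< (≤-<-trans (+-monoˡ-≤ s (s≤s z≤n)) r′<m)
                                 (≤-<-trans (+-monoˡ-≤ u (s≤s z≤n)) b<ℓ)) mℓ≤N
      su≡0 : suc s * suc u ≡ 0
      su≡0 = %-injective N (suc s * suc u) 0 su<N (>-nonZero⁻¹ N)
        (%-cancelʳ-+ N (suc s * suc u) 0 X (trans (cong (_% N) (sym (expand r s a u i i′))) p))

  crossed-shifts : ∀ {ℓ m r r′ a b} i i′ → r < m → r′ < m → a < ℓ → b < ℓ → m * ℓ ≤ N → r ≢ r′ →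
    shift r i a + shift r′ i′ b ≡ shift r i b + shift r′ i′ a → a ≡ b
  crossed-shifts {ℓ} {m} {r} {r′} {a} {b} i i′ r<m r′<m a<ℓ b<ℓ mℓ≤N r≢r′ p with <-cmp a b | <-cmp r r′ | crossed r r′ i i′ a b p
  ... | tri≈ _ a≡b _ | _ | c = a≡b
  ... | _            | tri≈ _ r≡r′ _ | c = contradiction r≡r′ r≢r′
  ... | tri< a<b _ _ | tri< r<r′ _ _ | c = ⊥-elim (crossed-< r r′ i i′ a b r′<m b<ℓ mℓ≤N r<r′ a<b c)
  ... | tri> _ _ b<a | tri< r<r′ _ _ | c = ⊥-elim (crossed-< r r′ i i′ b a r′<m a<ℓ mℓ≤N r<r′ b<a (sym c))
  ... | tri< a<b _ _ | tri> _ _ r′<r | c = ⊥-elim (crossed-< r′ r i′ i a b r<m b<ℓ mℓ≤N r′<r a<b (swap r r′ i i′ b a (sym c)))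
  ... | tri> _ _ b<a | tri> _ _ r′<r | c = ⊥-elim (crossed-< r′ r i′ i b a r<m a<ℓ mℓ≤N r′<r b<a (swap r r′ i i′ a b c))

-- Schemes: base cycles with variable offsets.

-- σ k stands for (i + r k) mod N. In a base cycle, edge j joins tail σ j to tail σ j + diff σ j.
-- Classes range over [0, 2ℓ), the difference d of class c being opposite to n − d of class 2ℓ − 1 − c;
-- class-fold says that class picks one class out of each such pair.
record Scheme (ℓ N : ℕ) : Set where
  field
    class weight : Fin ℓ → ℕ
    vert tail    : (ℕ → ℕ) → Fin ℓ → ℕ
    fold         : Fin ℓ → ℕ
  diff : (ℕ → ℕ) → Fin ℓ → ℕ
  diff σ j = suc (class j * N + σ (weight j))
  Bounded : (ℕ → ℕ) → Set
  Bounded σ = ∀ k → σ k < N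
  field
    fold<         : ∀ j → fold j < ℓ
    fold-inj      : ∀ {j j′} → fold j ≡ fold j′ → j ≡ j′
    fold-onto     : ∀ {a} → a < ℓ → Σ (Fin ℓ) λ j → fold j ≡ a
    class-fold    : ∀ j → class j ≡ fold j ⊎ class j + fold j + 1 ≡ 2 * ℓ
    weight<       : ∀ j → weight j < ℓ
    vert<         : ∀ {σ} → Bounded σ → ∀ j → vert σ j < 1 + 2 * ℓ * N
    vert-inj      : ∀ {σ} → Bounded σ → ∀ {j j′} → vert σ j ≡ vert σ j′ → j ≡ j′
    -- Keeps the sum of two tails below n, so that `edges-cross` can turn a congruence between such
    -- sums into an equality.
    tail≤         : ∀ {σ} → Bounded σ → ∀ j → tail σ j ≤ ℓ * N
    edge          : ∀ σ j → (vert σ j ≡ tail σ j × vert σ (nextPos j) ≡ tail σ j + diff σ j) ⊎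
                            (vert σ (nextPos j) ≡ tail σ j × vert σ j ≡ tail σ j + diff σ j)
    -- The last hypothesis reads tail σ j - tail σ j′ = tail τ j - tail τ j′: the two edges have the
    -- same relative position in both cycles. The conclusion σ a - τ a = σ b - τ b is what
    -- `crossed-shifts` excludes for a ≠ b.
    tail-separate : ∀ {σ τ j j′} → j ≢ j′ → weight j ≡ weight j′ → σ (weight j) ≡ τ (weight j) →
                    tail σ j + tail τ j′ ≡ tail σ j′ + tail τ j →
                    Σ ℕ λ a → Σ ℕ λ b → a < ℓ × b < ℓ × a ≢ b × σ a + τ b ≡ σ b + τ a

  2*ℓ : 2 * ℓ ≡ ℓ + ℓ
  2*ℓ = cong (ℓ +_) (+-identityʳ ℓ)

  fold-sum< : ∀ j j′ → fold j + fold j′ + 1 < 2 * ℓ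
  fold-sum< j j′ = begin-strict
    fold j + fold j′ + 1   ≡⟨ +-assoc (fold j) (fold j′) 1 ⟩
    fold j + (fold j′ + 1) <⟨ +-mono-<-≤ (fold< j) (≤-trans (≤-reflexive (+-comm (fold j′) 1)) (fold< j′)) ⟩
    ℓ + ℓ                  ≡⟨ 2*ℓ ⟨
    2 * ℓ                  ∎ where open ≤-Reasoning

  class<2ℓ : ∀ j → class j < 2 * ℓ
  class<2ℓ j with class-fold j
  ... | inj₁ p = subst (_< 2 * ℓ) (sym p) (≤-<-trans (≤-trans (m≤m+n (fold j) (fold j)) (m≤m+n _ 1)) (fold-sum< j j))
  ... | inj₂ p = subst (class j <_) p (≤-trans (≤-reflexive (sym (+-comm (class j) 1))) (+-monoˡ-≤ 1 (m≤m+n (class j) (fold j))))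

  odd≢even : ∀ a b → a + a + 1 ≢ 2 * b
  odd≢even a b p = even≢odd b a (trans (sym p) (trans (+-comm (a + a) 1) (cong suc (cong (a +_) (sym (+-identityʳ a))))))

  private
    class-sum-mixed : ∀ j j′ → class j ≡ fold j → class j′ + fold j′ + 1 ≡ 2 * ℓ →
                      class j + class j′ + 1 ≢ 2 * ℓ
    class-sum-mixed j j′ q q′ p = odd≢even (class j) ℓ (trans (cong (λ i → class j + class i + 1) j≡j′) p)
      where
      j≡j′ : j ≡ j′
      j≡j′ = fold-inj (trans (sym q) (+-cancelˡ-≡ (class j′) (class j) (fold j′)
        (+-cancelʳ-≡ 1 _ _ (trans (cong (_+ 1) (+-comm (class j′) (class j))) (trans p (sym q′))))))

  -- Two folds have too small a sum, two mirrored folds too large a one. In the mixed case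
  -- `fold-inj` forces j = j′, and then an odd number would be even.
  class-sum : ∀ j j′ → class j + class j′ + 1 ≢ 2 * ℓ
  class-sum j j′ p with class-fold j | class-fold j′
  ... | inj₁ q | inj₁ q′ = <⇒≢ (fold-sum< j j′) (trans (cong₂ (λ u v → u + v + 1) (sym q) (sym q′)) p)
  ... | inj₁ q | inj₂ q′ = class-sum-mixed j j′ q q′ p
  ... | inj₂ q | inj₁ q′ = class-sum-mixed j′ j q′ q (trans (cong (_+ 1) (+-comm (class j′) (class j))) p)
  ... | inj₂ q | inj₂ q′ = <⇒≢ (fold-sum< j j′) (+-cancelˡ-≡ (2 * ℓ) _ _ (begin
      2 * ℓ + (fold j + fold j′ + 1)                    ≡⟨ cong (_+ (fold j + fold j′ + 1)) p ⟨
      class j + class j′ + 1 + (fold j + fold j′ + 1)   ≡⟨ regroup (class j) (class j′) (fold j) (fold j′) ⟩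
      class j + fold j + 1 + (class j′ + fold j′ + 1)   ≡⟨ cong₂ _+_ q q′ ⟩
      2 * ℓ + 2 * ℓ                                     ∎))
    where
    open ≡-Reasoning
    regroup : ∀ c c′ f f′ → c + c′ + 1 + (f + f′ + 1) ≡ c + f + 1 + (c′ + f′ + 1)
    regroup = solve-∀

  class-inj : ∀ {j j′} → class j ≡ class j′ → j ≡ j′
  class-inj {j} {j′} p with class-fold j | class-fold j′
  ... | inj₁ q | inj₁ q′ = fold-inj (trans (sym q) (trans p q′))
  ... | inj₁ q | inj₂ q′ = ⊥-elim (<⇒≢ (fold-sum< j j′)
    (trans (cong (λ u → u + fold j′ + 1) (trans (sym q) p)) q′))
  ... | inj₂ q | inj₁ q′ = ⊥-elim (<⇒≢ (fold-sum< j′ j)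
    (trans (cong (λ u → u + fold j + 1) (trans (sym q′) (sym p))) q))
  ... | inj₂ q | inj₂ q′ = fold-inj (+-cancelˡ-≡ (class j) _ _ (+-cancelʳ-≡ 1 _ _
    (trans q (trans (sym q′) (cong (λ u → u + fold j′ + 1) (sym p))))))

  class-onto : ∀ {a} → a < 2 * ℓ → Σ (Fin ℓ) λ j → class j ≡ a ⊎ class j + a + 1 ≡ 2 * ℓ
  class-onto {a} a<2ℓ with a <? ℓ
  ... | yes a<ℓ = let j , q = fold-onto a<ℓ in j , direct j q (class-fold j)
    where
    direct : ∀ j → fold j ≡ a → class j ≡ fold j ⊎ class j + fold j + 1 ≡ 2 * ℓ →
             class j ≡ a ⊎ class j + a + 1 ≡ 2 * ℓ
    direct j refl = id
  ... | no a≮ℓ = let j , q = fold-onto b<ℓ in j , mirrored j q (class-fold j)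
    where
    b = 2 * ℓ ∸ suc a
    b+a+1 : b + a + 1 ≡ 2 * ℓ
    b+a+1 = trans (+-assoc b a 1) (trans (cong (b +_) (+-comm a 1)) (m∸n+n≡m a<2ℓ))
    b<ℓ : b < ℓ
    b<ℓ = +-cancelʳ-< a b ℓ (begin-strict
      b + a      <⟨ n<1+n (b + a) ⟩
      suc (b + a) ≡⟨ +-comm 1 (b + a) ⟩
      b + a + 1  ≡⟨ trans b+a+1 2*ℓ ⟩
      ℓ + ℓ      ≤⟨ +-monoʳ-≤ ℓ (≮⇒≥ a≮ℓ) ⟩
      ℓ + a      ∎) where open ≤-Reasoning
    mirrored : ∀ j → fold j ≡ b → class j ≡ fold j ⊎ class j + fold j + 1 ≡ 2 * ℓ →
               class j ≡ a ⊎ class j + a + 1 ≡ 2 * ℓ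
    mirrored j q (inj₁ p) = inj₂ (trans (cong (λ u → u + a + 1) (trans p q)) b+a+1)
    mirrored j q (inj₂ p) = inj₁ (+-cancelˡ-≡ b (class j) a (+-cancelʳ-≡ 1 _ _ (begin
      b + class j + 1       ≡⟨ cong (_+ 1) (+-comm b (class j)) ⟩
      class j + b + 1       ≡⟨ cong (λ u → class j + u + 1) q ⟨
      class j + fold j + 1  ≡⟨ trans p (sym b+a+1) ⟩
      b + a + 1             ∎))) where open ≡-Reasoning

-- Each difference up to sign occurs exactly once.

module Differences {ℓ N : ℕ} .{{_ : NonZero N}} (S : Scheme ℓ N) where
  open Scheme S

  K : ℕ
  K = 2 * ℓ * N

  diff≤K : ∀ {σ} → Bounded σ → ∀ j → diff σ j ≤ K
  diff≤K {σ} σ<N j = begin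
    suc (class j * N + σ (weight j)) ≡⟨ +-suc (class j * N) _ ⟨
    class j * N + suc (σ (weight j)) ≤⟨ +-monoʳ-≤ (class j * N) (σ<N (weight j)) ⟩
    class j * N + N                  ≡⟨ +-comm (class j * N) N ⟩
    suc (class j) * N                ≤⟨ *-monoˡ-≤ N (class<2ℓ j) ⟩
    K                                ∎ where open ≤-Reasoning

  diff-injective : ∀ {σ τ} → Bounded σ → Bounded τ → ∀ {j j′} → diff σ j ≡ diff τ j′ →
                   j ≡ j′ × σ (weight j) ≡ τ (weight j)
  diff-injective {σ} {τ} σ<N τ<N {j} {j′} p
    with quotRem-unique N {class j} {class j′} (σ<N (weight j)) (τ<N (weight j′)) (suc-injective p)
  ... | c≡c′ , t≡t′ with refl ← class-inj {j} {j′} c≡c′ = refl , t≡t′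

  -- If the sum were n, the offsets would contribute t + t′ + 1 to 2ℓN. This lies strictly between 0
  -- and 2N, which leaves only class j + class j′ + 1 = 2ℓ.
  diff-sum : ∀ {σ τ} → Bounded σ → Bounded τ → ∀ j j′ → diff σ j + diff τ j′ ≢ suc K
  diff-sum {σ} {τ} σ<N τ<N j j′ p = class-sum j j′ (trans (+-comm _ 1) (≤-antisym c+c′<2ℓ 2ℓ≤1+c+c′))
    where
    c = class j + class j′
    t = σ (weight j)
    t′ = τ (weight j′)
    total : c * N + suc (t + t′) ≡ 2 * ℓ * N
    total = suc-injective (trans (regroup (class j) (class j′) t t′ N) p)
      where
      regroup : ∀ c c′ t t′ N → suc ((c + c′) * N + suc (t + t′)) ≡ suc (c * N + t) + suc (c′ * N + t′)
      regroup = solve-∀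
    c+c′<2ℓ : c < 2 * ℓ
    c+c′<2ℓ = *-cancelʳ-< N c (2 * ℓ) (subst (c * N <_) total (m<m+n (c * N) (s≤s z≤n)))
    2ℓ≤1+c+c′ : 2 * ℓ ≤ suc c
    2ℓ≤1+c+c′ = s≤s⁻¹ (*-cancelʳ-< N (2 * ℓ) (2 + c) (begin-strict
      2 * ℓ * N            ≡⟨ total ⟨
      c * N + suc (t + t′) <⟨ +-monoʳ-< (c * N) (≤-trans (≤-reflexive (sym (+-suc (suc t) t′))) (+-mono-≤ (σ<N (weight j)) (τ<N (weight j′)))) ⟩
      c * N + (N + N)      ≡⟨ regroup c N ⟩
      (2 + c) * N          ∎))
      where
      open ≤-Reasoning
      regroup : ∀ c N → c * N + (N + N) ≡ (2 + c) * N
      regroup = solve-∀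

  diff-onto : ∀ {δ} → δ < K → Σ (Fin ℓ) λ j → Σ ℕ λ t → t < N ×
              (suc (class j * N + t) ≡ suc δ ⊎ suc (class j * N + t) + suc δ ≡ suc K)
  diff-onto {δ} δ<K with class-onto {δ / N} (m<n*o⇒m/o<n δ<K)
  ... | j , inj₁ q = j , δ % N , m%n<n δ N , inj₁ (cong suc (begin
      class j * N + δ % N  ≡⟨ cong (λ u → u * N + δ % N) q ⟩
      δ / N * N + δ % N    ≡⟨ +-comm (δ / N * N) (δ % N) ⟩
      δ % N + δ / N * N    ≡⟨ m≡m%n+[m/n]*n δ N ⟨
      δ                    ∎)) where open ≡-Reasoning
  ... | j , inj₂ q = j , t , t<N , inj₂ (begin
      suc (class j * N + t) + suc δ                        ≡⟨ cong (λ u → suc (class j * N + t) + suc u) (m≡m%n+[m/n]*n δ N) ⟩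
      suc (class j * N + t) + suc (δ % N + δ / N * N)      ≡⟨ regroup (class j) t (δ % N) (δ / N) N ⟩
      suc ((class j + δ / N) * N + (t + suc (δ % N)))      ≡⟨ cong (λ u → suc ((class j + δ / N) * N + u)) t+1+δ%N ⟩
      suc ((class j + δ / N) * N + N)                      ≡⟨ cong suc (regroup′ (class j + δ / N) N) ⟩
      suc ((class j + δ / N + 1) * N)                      ≡⟨ cong (λ u → suc (u * N)) q ⟩
      suc K                                                ∎)
    where
    open ≡-Reasoning
    -- Replacing d by n - d reverses the order of the offsets within a class.
    t = N ∸ suc (δ % N)
    t+1+δ%N : t + suc (δ % N) ≡ N
    t+1+δ%N = m∸n+n≡m (m%n<n δ N)
    t<N : t < N
    t<N = subst (t <_) t+1+δ%N (m<m+n t (s≤s z≤n))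
    regroup : ∀ c t r q N → suc (c * N + t) + suc (r + q * N) ≡ suc ((c + q) * N + (t + suc r))
    regroup = solve-∀
    regroup′ : ∀ c N → c * N + N ≡ (c + 1) * N
    regroup′ = solve-∀

-- Edges of translated cycles modulo n.

module Arcs {ℓ N : ℕ} .{{_ : NonZero N}} (S : Scheme ℓ N) where
  open Scheme S
  open Differences S

  n : ℕ
  n = suc K

  residue : ℕ → Fin n
  residue a = fromℕ< (m%n<n a n)

  toℕ-residue : ∀ a → toℕ (residue a) ≡ a % n
  toℕ-residue a = toℕ-fromℕ< (m%n<n a n)

  residue≡ : ∀ a {x : Fin n} → a % n ≡ toℕ x → residue a ≡ x
  residue≡ a p = toℕ-injective (trans (toℕ-residue a) p)

  residue-injective : ∀ a b → residue a ≡ residue b → a % n ≡ b % n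
  residue-injective a b p = trans (sym (toℕ-residue a)) (trans (cong toℕ p) (toℕ-residue b))

  toℕ-% : (x : Fin n) → toℕ x % n ≡ toℕ x
  toℕ-% x = m<n⇒m%n≡m (toℕ<n x)

  translate : ∀ {σ} → Bounded σ → Fin n → Cycle ℓ n
  translate {σ} σ<N g = cycle (λ j → residue (vert σ j + toℕ g)) λ {j} {j′} p →
    vert-inj σ<N (%-injective n (vert σ j) (vert σ j′) (vert< σ<N j) (vert< σ<N j′)
      (%-cancelʳ-+ n (vert σ j) (vert σ j′) (toℕ g) (residue-injective (vert σ j + toℕ g) (vert σ j′ + toℕ g) p)))

  -- Edges are oriented by their difference, not by the direction of traversal; the sign with which
  -- a difference enters the cycle is visible only in `Scheme.edge`.
  Arc : (ℕ → ℕ) → Fin n → Fin ℓ → Fin n → Fin n → Set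
  Arc σ g j x y = residue (tail σ j + toℕ g) ≡ x × residue (tail σ j + diff σ j + toℕ g) ≡ y

  Edge : (ℕ → ℕ) → Fin n → Fin ℓ → Fin n → Fin n → Set
  Edge σ g j x y = Arc σ g j x y ⊎ Arc σ g j y x

  edgeOf⇒edge : ∀ {σ} (σ<N : Bounded σ) g {x y} → EdgeOf (translate σ<N g) x y → Σ (Fin ℓ) λ j → Edge σ g j x y
  edgeOf⇒edge {σ} σ<N g (j , e) with edge σ j | e
  ... | inj₁ (p , q) | inj₁ (u , v) rewrite p | q = j , inj₁ (u , v)
  ... | inj₁ (p , q) | inj₂ (u , v) rewrite p | q = j , inj₂ (u , v)
  ... | inj₂ (p , q) | inj₁ (u , v) rewrite p | q = j , inj₂ (v , u)
  ... | inj₂ (p , q) | inj₂ (u , v) rewrite p | q = j , inj₁ (v , u)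

  edge⇒edgeOf : ∀ {σ} (σ<N : Bounded σ) g {x y} j → Edge σ g j x y → EdgeOf (translate σ<N g) x y
  edge⇒edgeOf {σ} σ<N g {x} {y} j e = j , sides (edge σ j) e
    where
    v = λ i → residue (vert σ i + toℕ g)
    sides : _ ⊎ _ → Edge σ g j x y → (v j ≡ x × v (nextPos j) ≡ y) ⊎ (v j ≡ y × v (nextPos j) ≡ x)
    sides (inj₁ (p , q)) e rewrite p | q = e
    sides (inj₂ (p , q)) (inj₁ (u , w)) rewrite p | q = inj₂ (w , u)
    sides (inj₂ (p , q)) (inj₂ (u , w)) rewrite p | q = inj₁ (w , u)

  arc-diff : ∀ {σ g j x y} → Arc σ g j x y → (toℕ x + diff σ j) % n ≡ toℕ y
  arc-diff {σ} {g} {j} (refl , refl) = begin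
    (toℕ (residue (T + toℕ g)) + D) % n ≡⟨ cong (λ u → (u + D) % n) (toℕ-residue (T + toℕ g)) ⟩
    ((T + toℕ g) % n + D) % n           ≡⟨ %-cong-+ n {(T + toℕ g) % n} {T + toℕ g} (m%n%n≡m%n (T + toℕ g) n) refl ⟩
    (T + toℕ g + D) % n                 ≡⟨ cong (_% n) (regroup T (toℕ g) D) ⟩
    (T + D + toℕ g) % n                 ≡⟨ toℕ-residue (T + D + toℕ g) ⟨
    toℕ (residue (T + D + toℕ g))       ∎
    where
    open ≡-Reasoning
    T = tail σ j
    D = diff σ j
    regroup : ∀ a b c → a + b + c ≡ a + c + b
    regroup = solve-∀

  -- All that a shared edge reveals: its difference gives the position and the offset, its starting
  -- point the tail.
  record Agree (σ τ : ℕ → ℕ) (g g′ : Fin n) (j j′ : Fin ℓ) : Set where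
    field
      same-position : j ≡ j′
      same-shift    : σ (weight j) ≡ τ (weight j)
      same-tail     : residue (tail σ j + toℕ g) ≡ residue (tail τ j + toℕ g′)

  arc-agree : ∀ {σ τ} → Bounded σ → Bounded τ → ∀ {g g′ j j′ x y} →
              Arc σ g j x y → Arc τ g′ j′ x y → Agree σ τ g g′ j j′
  arc-agree {σ} {τ} σ<N τ<N {g} {g′} {j} {j′} {x} A A′
    with refl , same-shift ← diff-injective σ<N τ<N {j} {j′} (%-injective n (diff σ j) (diff τ j′) (s≤s (diff≤K σ<N j)) (s≤s (diff≤K τ<N j′))
      (%-cancelʳ-+ n (diff σ j) (diff τ j′) (toℕ x) (trans (cong (_% n) (+-comm (diff σ j) (toℕ x)))
        (trans (arc-diff A) (trans (sym (arc-diff A′)) (cong (_% n) (+-comm (toℕ x) (diff τ j′))))))))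
    = record { same-position = refl ; same-shift = same-shift ; same-tail = trans (proj₁ A) (sym (proj₁ A′)) }

  -- The two differences would add up to 0 modulo n. Each lies in [1, n - 1], so their sum would be
  -- n itself, against `diff-sum`.
  arc-not-reversed : ∀ {σ τ} → Bounded σ → Bounded τ → ∀ {g g′ j j′ x y} →
                     Arc σ g j x y → Arc τ g′ j′ y x → ⊥
  arc-not-reversed {σ} {τ} σ<N τ<N {g} {g′} {j} {j′} {x} {y} A A′ with m%n≡0⇒n∣m total n total%n
    where
    total = diff σ j + diff τ j′
    total%n : total % n ≡ 0
    total%n = %-cancelʳ-+ n total 0 (toℕ x) (begin
      (diff σ j + diff τ j′ + toℕ x) % n          ≡⟨ cong (_% n) (regroup (diff σ j) (diff τ j′) (toℕ x)) ⟩
      (toℕ x + diff σ j + diff τ j′) % n          ≡⟨ %-cong-+ n {toℕ x + diff σ j} {toℕ y} (trans (arc-diff A) (sym (toℕ-% y))) refl ⟩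
      (toℕ y + diff τ j′) % n                     ≡⟨ arc-diff A′ ⟩
      toℕ x                                       ≡⟨ toℕ-% x ⟨
      toℕ x % n                                   ∎)
      where
      open ≡-Reasoning
      regroup : ∀ a b c → a + b + c ≡ c + a + b
      regroup = solve-∀
  ... | divides 0 ()
  ... | divides 1 p = diff-sum σ<N τ<N j j′ (trans p (*-identityˡ n))
  ... | divides (suc (suc q)) p = <⇒≢ (begin-strict
      diff σ j + diff τ j′  ≤⟨ +-mono-≤ (diff≤K σ<N j) (diff≤K τ<N j′) ⟩
      K + K                 <⟨ +-mono-<-≤ (n<1+n K) (≤-trans (n≤1+n K) (m≤m+n n (q * n))) ⟩
      n + (n + q * n)       ∎) p
    where open ≤-Reasoning

  edge-agree : ∀ {σ τ} → Bounded σ → Bounded τ → ∀ {g g′ j j′ x y} →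
               Edge σ g j x y → Edge τ g′ j′ x y → Agree σ τ g g′ j j′
  edge-agree σ<N τ<N (inj₁ A) (inj₁ A′) = arc-agree σ<N τ<N A A′
  edge-agree σ<N τ<N (inj₁ A) (inj₂ A′) = ⊥-elim (arc-not-reversed σ<N τ<N A A′)
  edge-agree σ<N τ<N (inj₂ A) (inj₁ A′) = ⊥-elim (arc-not-reversed σ<N τ<N A A′)
  edge-agree σ<N τ<N (inj₂ A) (inj₂ A′) = arc-agree σ<N τ<N A A′

  edge-determined : ∀ {σ g j x y u v} → Edge σ g j x y → Edge σ g j u v → SameEdge x y u v
  edge-determined (inj₁ (refl , refl)) (inj₁ (refl , refl)) = inj₁ (refl , refl)
  edge-determined (inj₁ (refl , refl)) (inj₂ (refl , refl)) = inj₂ (refl , refl)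
  edge-determined (inj₂ (refl , refl)) (inj₁ (refl , refl)) = inj₂ (refl , refl)
  edge-determined (inj₂ (refl , refl)) (inj₂ (refl , refl)) = inj₁ (refl , refl)

  -- For different weights, adding the two agreements of offsets crosswise gives the equation. For
  -- equal weights they coincide, so the tails are compared instead; the translations g and g′ then
  -- cancel.
  edges-cross : ∀ {σ τ} → Bounded σ → Bounded τ → ∀ {g g′ j k x y u v} → j ≢ k →
    Edge σ g j x y → Edge τ g′ j x y → Edge σ g k u v → Edge τ g′ k u v →
    Σ ℕ λ a → Σ ℕ λ b → a < ℓ × b < ℓ × a ≢ b × σ a + τ b ≡ σ b + τ a
  edges-cross {σ} {τ} σ<N τ<N {g} {g′} {j} {k} j≢k e e′ f f′ with weight j ≟ weight k
  ... | no wj≢wk = weight j , weight k , weight< j , weight< k , wj≢wk ,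
        trans (cong₂ _+_ (same-shift E) (sym (same-shift F))) (+-comm (τ (weight j)) (σ (weight k)))
    where
    open Agree
    E = edge-agree σ<N τ<N e e′
    F = edge-agree σ<N τ<N f f′
  ... | yes wj≡wk = tail-separate j≢k wj≡wk (same-shift E)
        (%-injective n (tail σ j + tail τ k) (tail σ k + tail τ j) (small σ<N j τ<N k) (small σ<N k τ<N j)
        (%-cancelʳ-+ n (tail σ j + tail τ k) (tail σ k + tail τ j) (toℕ g + toℕ g′) (begin
          (tail σ j + tail τ k + (toℕ g + toℕ g′)) % n   ≡⟨ cong (_% n) (regroup (tail σ j) (tail τ k) (toℕ g) (toℕ g′)) ⟩
          (tail σ j + toℕ g + (tail τ k + toℕ g′)) % n   ≡⟨ %-cong-+ n {tail σ j + toℕ g} {tail τ j + toℕ g′} {tail τ k + toℕ g′} {tail σ k + toℕ g}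
                                                              (residue-injective (tail σ j + toℕ g) (tail τ j + toℕ g′) (same-tail E)) (sym (residue-injective (tail σ k + toℕ g) (tail τ k + toℕ g′) (same-tail F))) ⟩
          (tail τ j + toℕ g′ + (tail σ k + toℕ g)) % n   ≡⟨ cong (_% n) (regroup′ (tail τ j) (tail σ k) (toℕ g) (toℕ g′)) ⟩
          (tail σ k + tail τ j + (toℕ g + toℕ g′)) % n   ∎)))
    where
    open Agree
    open ≡-Reasoning
    E = edge-agree σ<N τ<N e e′
    F = edge-agree σ<N τ<N f f′
    regroup : ∀ a b c d → a + b + (c + d) ≡ a + c + (b + d)
    regroup = solve-∀
    regroup′ : ∀ a b c d → a + d + (b + c) ≡ b + a + (c + d)
    regroup′ = solve-∀
    small : ∀ {σ τ} → Bounded σ → ∀ j → Bounded τ → ∀ k → tail σ j + tail τ k < n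
    small {σ} {τ} σ<N j τ<N k = s≤s (≤-trans (+-mono-≤ (tail≤ σ<N j) (tail≤ τ<N k))
      (≤-reflexive (trans (sym (*-distribʳ-+ N ℓ ℓ)) (cong (_* N) (sym 2*ℓ)))))

  -- The position and the offset depend on x and y alone and are fixed before σ. So a system can
  -- first pick the base cycle that has this offset at this position, and then the translation.
  ascending-cover : ∀ {x y : Fin n} → toℕ x < toℕ y →
    Σ (Fin ℓ) λ j → Σ ℕ λ t → t < N × (∀ σ → σ (weight j) ≡ t → Σ (Fin n) λ g → Edge σ g j x y)
  ascending-cover {x} {y} x<y with m≤n⇒∃[o]m+o≡n x<y
  ... | δ , 1+x+δ≡y with diff-onto {δ} (≤-trans (m+n≤o⇒n≤o (toℕ x) (≤-reflexive (trans (+-suc (toℕ x) δ) 1+x+δ≡y))) (s≤s⁻¹ (toℕ<n y)))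
  ... | j , t , t<N , δ-match = j , t , t<N , λ σ σw≡t → place σ σw≡t δ-match
    where
    x+1+δ≡y : toℕ x + suc δ ≡ toℕ y
    x+1+δ≡y = trans (+-suc (toℕ x) δ) 1+x+δ≡y
    arc-from : ∀ σ (u v : Fin n) → (toℕ u + diff σ j) % n ≡ toℕ v → Σ (Fin n) λ g → Arc σ g j u v
    arc-from σ u v p with shift-solve n (tail σ j) (toℕ<n u)
    ... | g , q = g , residue≡ (tail σ j + toℕ g) (trans (cong (_% n) (+-comm (tail σ j) (toℕ g))) q) , residue≡ (tail σ j + diff σ j + toℕ g) (begin
        (tail σ j + diff σ j + toℕ g) % n    ≡⟨ cong (_% n) (regroup (tail σ j) (diff σ j) (toℕ g)) ⟩
        (toℕ g + tail σ j + diff σ j) % n    ≡⟨ %-cong-+ n {toℕ g + tail σ j} {toℕ u} (trans q (sym (toℕ-% u))) refl ⟩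
        (toℕ u + diff σ j) % n               ≡⟨ p ⟩
        toℕ v                                ∎)
      where
      open ≡-Reasoning
      regroup : ∀ a b c → a + b + c ≡ c + a + b
      regroup = solve-∀
    place : ∀ σ → σ (weight j) ≡ t → _ ⊎ _ → Σ (Fin n) λ g → Edge σ g j x y
    place σ refl (inj₁ p) with arc-from σ x y (trans (cong (λ d → (toℕ x + d) % n) p) (trans (cong (_% n) x+1+δ≡y) (toℕ-% y)))
    ... | g , A = g , inj₁ A
    place σ refl (inj₂ p) with arc-from σ y x (begin
        (toℕ y + diff σ j) % n             ≡⟨ cong (λ u → (u + diff σ j) % n) x+1+δ≡y ⟨
        (toℕ x + suc δ + diff σ j) % n     ≡⟨ cong (_% n) (trans (+-assoc (toℕ x) (suc δ) _) (cong (toℕ x +_) (trans (+-comm (suc δ) _) p))) ⟩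
        (toℕ x + n) % n                    ≡⟨ [m+n]%n≡m%n (toℕ x) n ⟩
        toℕ x % n                          ≡⟨ toℕ-% x ⟩
        toℕ x                              ∎)
      where open ≡-Reasoning
    ... | g , A = g , inj₂ A

  cover : ∀ {x y : Fin n} → x ≢ y →
    Σ (Fin ℓ) λ j → Σ ℕ λ t → t < N × (∀ σ → σ (weight j) ≡ t → Σ (Fin n) λ g → Edge σ g j x y)
  cover {x} {y} x≢y with <-cmp (toℕ x) (toℕ y)
  ... | tri< x<y _ _ = ascending-cover x<y
  ... | tri≈ _ x≡y _ = contradiction (toℕ-injective x≡y) x≢y
  ... | tri> _ _ y<x with ascending-cover y<x
  ... | j , t , t<N , h = j , t , t<N , λ σ p → proj₁ (h σ p) , Sum.swap (proj₂ (h σ p))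

-- Lists indexed by pairs.

module _ {A : Set} {M M′ : ℕ} (f : Fin M → Fin M′ → A) where
  private
    entry : Fin (M * M′) → A
    entry = uncurry f ∘ remQuot M′

  table : List A
  table = tabulate entry

  private
    len = length-tabulate entry

  key : Fin (length table) → Fin M × Fin M′
  key k = remQuot M′ (cast len k)

  slot : Fin M → Fin M′ → Fin (length table)
  slot a b = cast (sym len) (combine a b)

  lookup-key : ∀ k → lookup table k ≡ uncurry f (key k)
  lookup-key k = trans (cong (lookup table) (sym (cast-involutive (sym len) len k)))
                       (lookup-tabulate entry (cast len k))

  lookup-slot : ∀ a b → lookup table (slot a b) ≡ f a b
  lookup-slot a b = trans (lookup-tabulate entry (combine a b)) (cong (uncurry f) (remQuot-combine a b))

  key-injective : ∀ {k k′} → key k ≡ key k′ → k ≡ k′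
  key-injective {k} {k′} p = trans (sym (slot-key k)) (trans (cong (uncurry slot) p) (slot-key k′))
    where
    slot-key : ∀ k → uncurry slot (key k) ≡ k
    slot-key k = trans (cong (cast (sym len)) (combine-remQuot {M} M′ (cast len k)))
                       (cast-involutive (sym len) len k)

edgeOfSeq-cong : ∀ {ℓ n} {c d : Fin ℓ → Fin n} → (∀ i → c i ≡ d i) → ∀ {x y} → EdgeOfSeq c x y → EdgeOfSeq d x y
edgeOfSeq-cong p (i , inj₁ (u , v)) = i , inj₁ (trans (sym (p i)) u , trans (sym (p (nextPos i))) v)
edgeOfSeq-cong p (i , inj₂ (u , v)) = i , inj₂ (trans (sym (p i)) u , trans (sym (p (nextPos i))) v)

-- The cyclic system of a parameter, and orthogonality.

module Family {ℓ N : ℕ} .{{_ : NonZero N}} (S : Scheme ℓ N) where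
  open Scheme S
  open Arcs S
  open Shifts N

  base : ℕ → Fin N → Fin n → Cycle ℓ n
  base r i = translate (shift< r (toℕ i))

  edge-in : ∀ r k {x y} → EdgeOf (lookup (table (base r)) k) x y →
            Σ (Fin ℓ) λ j → Edge (shift r (toℕ (proj₁ (key (base r) k)))) (proj₂ (key (base r) k)) j x y
  edge-in r k {x} {y} e = edgeOf⇒edge (shift< r _) _ (subst (λ C → EdgeOf C x y) (lookup-key (base r) k) e)

  -- With the same r on both sides, equal offsets at one position force i = i′; the tails then
  -- differ only by the translations, which forces g = g′.
  edge-determines-key : ∀ r {i i′ g g′ j j′ x y} →
    Edge (shift r (toℕ i)) g j x y → Edge (shift r (toℕ i′)) g′ j′ x y → (i , g) ≡ (i′ , g′)
  edge-determines-key r {i} {i′} {g} {g′} {j} {j′} e e′ = cong₂ _,_ i≡i′ g≡g′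
    where
    σ = shift r (toℕ i)
    τ = shift r (toℕ i′)
    agree : Agree σ τ g g′ j j′
    agree = edge-agree (shift< r (toℕ i)) (shift< r (toℕ i′)) e e′
    open Agree agree
    i≡i′ : i ≡ i′
    i≡i′ = toℕ-injective (shift-injective r (weight j) (toℕ<n i) (toℕ<n i′) same-shift)
    tails : residue (tail σ j + toℕ g) ≡ residue (tail σ j + toℕ g′)
    tails = trans same-tail (cong (λ h → residue (tail (shift r (toℕ h)) j + toℕ g′)) (sym i≡i′))
    g≡g′ : g ≡ g′
    g≡g′ = toℕ-injective (%-injective n (toℕ g) (toℕ g′) (toℕ<n g) (toℕ<n g′)
      (%-cancelʳ-+ n (toℕ g) (toℕ g′) (tail σ j) (begin
        (toℕ g + tail σ j) % n   ≡⟨ cong (_% n) (+-comm (toℕ g) (tail σ j)) ⟩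
        (tail σ j + toℕ g) % n   ≡⟨ residue-injective (tail σ j + toℕ g) (tail σ j + toℕ g′) tails ⟩
        (tail σ j + toℕ g′) % n  ≡⟨ cong (_% n) (+-comm (tail σ j) (toℕ g′)) ⟩
        (toℕ g′ + tail σ j) % n  ∎)))
      where open ≡-Reasoning

  system : ℕ → CycleSystem ℓ n
  system r = record
    { cycles = table (base r)
    ; covers = covered
    ; unique = λ x y k k′ e e′ → key-injective (base r)
        (edge-determines-key r (proj₂ (edge-in r k e)) (proj₂ (edge-in r k′ e′)))
    }
    where
    covered : ∀ x y → x ≢ y → Σ _ λ k → EdgeOf (lookup (table (base r)) k) x y
    covered x y x≢y =
      let j , t , t<N , placed = cover x≢y
          i , p = shift-solve N (r * weight j) t<N
          g , e = placed (shift r (toℕ i)) p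
      in slot (base r) i g , subst (λ C → EdgeOf C x y) (sym (lookup-slot (base r) i g))
                                   (edge⇒edgeOf (shift< r (toℕ i)) g j e)

  base-⊕ : ∀ r i g₀ g j → vtx (base r i g₀) j ⊕ g ≡ vtx (base r i (g₀ ⊕ g)) j
  base-⊕ r i g₀ g j = toℕ-injective (begin
    toℕ (residue (V + toℕ g₀) ⊕ g)           ≡⟨ toℕ-residue (toℕ (residue (V + toℕ g₀)) + toℕ g) ⟩
    (toℕ (residue (V + toℕ g₀)) + toℕ g) % n ≡⟨ cong (λ u → (u + toℕ g) % n) (toℕ-residue (V + toℕ g₀)) ⟩
    ((V + toℕ g₀) % n + toℕ g) % n           ≡⟨ %-cong-+ n {(V + toℕ g₀) % n} {V + toℕ g₀} (m%n%n≡m%n (V + toℕ g₀) n) refl ⟩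
    (V + toℕ g₀ + toℕ g) % n                 ≡⟨ cong (_% n) (trans (+-assoc V (toℕ g₀) (toℕ g)) (+-comm V _)) ⟩
    (toℕ g₀ + toℕ g + V) % n                 ≡⟨ %-cong-+ n {toℕ g₀ + toℕ g} {(toℕ g₀ + toℕ g) % n} (sym (m%n%n≡m%n (toℕ g₀ + toℕ g) n)) refl ⟩
    ((toℕ g₀ + toℕ g) % n + V) % n           ≡⟨ cong (λ u → (u + V) % n) (toℕ-residue (toℕ g₀ + toℕ g)) ⟨
    (toℕ (g₀ ⊕ g) + V) % n                   ≡⟨ cong (_% n) (+-comm (toℕ (g₀ ⊕ g)) V) ⟩
    (V + toℕ (g₀ ⊕ g)) % n                   ≡⟨ toℕ-residue (V + toℕ (g₀ ⊕ g)) ⟨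
    toℕ (residue (V + toℕ (g₀ ⊕ g)))         ∎)
    where
    open ≡-Reasoning
    V = vert (shift r (toℕ i)) j

  base-translate : ∀ r i g₀ g x y → EdgeOf (base r i (g₀ ⊕ g)) x y ⇔ EdgeOfTranslate (base r i g₀) g x y
  base-translate r i g₀ g x y =
    mk⇔ (edgeOfSeq-cong (λ j → sym (base-⊕ r i g₀ g j))) (edgeOfSeq-cong (base-⊕ r i g₀ g))

  system-cyclic : ∀ r → IsCyclic (system r)
  system-cyclic r k g =
    let i , g₀ = key (base r) k
    in slot (base r) i (g₀ ⊕ g) , λ x y → subst₂ (λ C D → EdgeOf C x y ⇔ EdgeOfTranslate D g x y)
         (sym (lookup-slot (base r) i (g₀ ⊕ g))) (sym (lookup-key (base r) k)) (base-translate r i g₀ g x y)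

  two-common-edges : ∀ {m r r′} → m * ℓ ≤ N → r < m → r′ < m → r ≢ r′ →
    ∀ {i i′ g g′ j j₁ h h₁ x y u v} →
    Edge (shift r i) g j x y → Edge (shift r′ i′) g′ j₁ x y →
    Edge (shift r i) g h u v → Edge (shift r′ i′) g′ h₁ u v → SameEdge x y u v
  two-common-edges {m} {r} {r′} mℓ≤N r<m r′<m r≢r′ {i} {i′} {g} {g′} {j} {j₁} {h} {h₁} {x} {y} {u} {v} e e′ f f′
    with j Fin.≟ h
  ... | yes refl = edge-determined {shift r i} {g} {j} e f
  ... | no j≢h =
    let a , b , a<ℓ , b<ℓ , a≢b , p = edges-cross σ< τ< j≢h e
          (subst (λ p → Edge τ g′ p x y) (sym (same-position (edge-agree σ< τ< e e′))) e′) f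
          (subst (λ p → Edge τ g′ p u v) (sym (same-position (edge-agree σ< τ< f f′))) f′)
    in contradiction (crossed-shifts i i′ r<m r′<m a<ℓ b<ℓ mℓ≤N r≢r′ p) a≢b
    where
    open Agree
    τ = shift r′ i′
    σ< = shift< r i
    τ< = shift< r′ i′

  system-orthogonal : ∀ {m r r′} → m * ℓ ≤ N → r < m → r′ < m → r ≢ r′ → Orthogonal (system r) (system r′)
  system-orthogonal {m} {r} {r′} mℓ≤N r<m r′<m r≢r′ k k′ x y u v e e′ f f′ =
    two-common-edges {m} mℓ≤N r<m r′<m r≢r′
      (proj₂ (edge-in r k e)) (proj₂ (edge-in r′ k′ e′)) (proj₂ (edge-in r k f)) (proj₂ (edge-in r′ k′ f′))

  family : ∀ m → m * ℓ ≤ N → MOCyclicFamily ℓ n m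
  family m mℓ≤N = system ∘ toℕ , system-cyclic ∘ toℕ , λ a b a≢b →
    system-orthogonal {m} mℓ≤N (toℕ<n a) (toℕ<n b) (a≢b ∘ toℕ-injective)

-- Zigzag cycles of length 2h with h > 2.

toℕ-nextPos-< : ∀ {ℓ} (i : Fin ℓ) → suc (toℕ i) < ℓ → toℕ (nextPos i) ≡ suc (toℕ i)
toℕ-nextPos-< {suc k} i 1+i<ℓ = trans (toℕ-fromℕ< (m%n<n (suc (toℕ i)) (suc k))) (m<n⇒m%n≡m 1+i<ℓ)

toℕ-nextPos-≡ : ∀ {ℓ} (i : Fin ℓ) → suc (toℕ i) ≡ ℓ → toℕ (nextPos i) ≡ 0
toℕ-nextPos-≡ {suc k} i 1+i≡ℓ =
  trans (toℕ-fromℕ< (m%n<n (suc (toℕ i)) (suc k))) (trans (cong (_% suc k) 1+i≡ℓ) (n%n≡0 (suc k)))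

stepwise : ∀ {A : Set} (_⊏_ : A → A → Set) → (∀ {a b c} → a ⊏ b → b ⊏ c → a ⊏ c) →
  ∀ {h} (f : ℕ → A) → (∀ k → suc k < h → f k ⊏ f (suc k)) → ∀ {a b} → a < b → b < h → f a ⊏ f b
stepwise _⊏_ ⊏-trans {h} f step {a} a<b b<h with m≤n⇒∃[o]m+o≡n a<b
... | d , refl = go d b<h
  where
  go : ∀ d → suc a + d < h → f a ⊏ f (suc a + d)
  go zero    p rewrite +-identityʳ a = step a p
  go (suc d) p rewrite +-suc a d = ⊏-trans (go d (<-trans (n<1+n _) p)) (step (suc (a + d)) p)

-- The cycle y₀ x₀ y₁ x₁ … of length 2h with (indices of σ mod h)
--   x_k = level k · N + σ (k+1),   y_k = (level k + class 2k) · N + 1 + σ k + σ (k+1).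
-- Its edges have differences y_k − x_k = class 2k · N + 1 + σ k and
-- y_{k+1} − x_k = class (2k+1) · N + 1 + σ (k+2); the x_k decrease, the y_k increase, x₀ < y₀.
record Zigzag (h : ℕ) : Set where
  field
    level class fold unfold : ℕ → ℕ
    -- The step into the last position is exempt: that class is reserved for closing the cycle.
    class-step      : ∀ p → 2 + p < h * 2 → class p < class (suc p)
    level-step      : ∀ k → suc k < h → level (suc k) + class (2 * suc k) ≡ level k + class (suc (2 * k))
    -- Together with `level-step` this amounts to class 0 - class 1 + class 2 - ... - class (2h - 1)
    -- = 0.
    level-close     : ∀ k → suc k ≡ h → level 0 + class 0 ≡ level k + class (suc (2 * k))
    level<          : level 0 < h * 2
    top≤            : ∀ k → suc k ≡ h → level k + class (2 * k) ≤ h * 2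
    fold<           : ∀ {p} → p < h * 2 → fold p < h * 2
    unfold<         : ∀ {a} → a < h * 2 → unfold a < h * 2
    unfold-fold     : ∀ {p} → p < h * 2 → unfold (fold p) ≡ p
    fold-unfold     : ∀ {a} → a < h * 2 → fold (unfold a) ≡ a
    class-fold      : ∀ {p} → p < h * 2 → class p ≡ fold p ⊎ class p + fold p + 1 ≡ 2 * (h * 2)

2k+3<2h : ∀ {k h} → suc k < h → 3 + 2 * k < h * 2
2k+3<2h {k} {h} p = subst (_≤ h * 2) (regroup k) (*-monoˡ-≤ 2 p)
  where
  regroup : ∀ k → (2 + k) * 2 ≡ 4 + 2 * k
  regroup = solve-∀

2k+2<2h : ∀ {k h} → suc k < h → 2 + 2 * k < h * 2
2k+2<2h p = <-trans (n<1+n _) (2k+3<2h p)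

module _ (h N : ℕ) .{{_ : NonZero h}} .{{_ : NonZero N}} (2<h : 2 < h) (Z : Zigzag h) where
  open Zigzag Z

  private
    block< : ∀ {a b s} → a < b → s < N → ∀ t → a * N + s < b * N + t
    block< {a} {b} {s} a<b s<N t = begin-strict
      a * N + s  <⟨ +-monoʳ-< (a * N) s<N ⟩
      a * N + N  ≡⟨ +-comm (a * N) N ⟩
      suc a * N  ≤⟨ *-monoˡ-≤ N a<b ⟩
      b * N      ≤⟨ m≤m+n (b * N) t ⟩
      b * N + t  ∎ where open ≤-Reasoning

    top : ℕ → ℕ
    top k = level k + class (2 * k)

    level-decreasing : ∀ k → suc k < h → level (suc k) < level k
    level-decreasing k p = +-cancelʳ-< (class (suc (2 * k))) (level (suc k)) (level k) (begin-strict
      level (suc k) + class (suc (2 * k))  <⟨ +-monoʳ-< (level (suc k)) (class-step (suc (2 * k)) (2k+3<2h p)) ⟩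
      level (suc k) + class (2 + 2 * k)    ≡⟨ cong (λ u → level (suc k) + class u) (*-suc 2 k) ⟨
      level (suc k) + class (2 * suc k)    ≡⟨ level-step k p ⟩
      level k + class (suc (2 * k))        ∎)
      where
      open ≤-Reasoning

    top-increasing : ∀ k → suc k < h → top k < top (suc k)
    top-increasing k p = subst (top k <_) (sym (level-step k p)) (+-monoʳ-< (level k) (class-step (2 * k) (2k+2<2h p)))

  module _ (σ : ℕ → ℕ) where
    σ° : ℕ → ℕ
    σ° k = σ (k % h)

    low high : ℕ → ℕ
    low k  = level k * N + σ° (suc k)
    high k = top k * N + suc (σ° k + σ° (suc k))

    node : Fin h × Fin 2 → ℕ
    node (k , zero)  = high (toℕ k)
    node (k , suc _) = low (toℕ k)

    module _ (σ<N : ∀ k → σ k < N) where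
      low-decreasing : ∀ k → suc k < h → low (suc k) < low k
      low-decreasing k p = block< (level-decreasing k p) (σ<N _) _

      -- A vertex y_k carries two offsets, whose sum may exceed a block. But y_k and y_{k+1} share
      -- `σ° (suc k)`; without it, each has a single offset left and the blocks decide.
      high-increasing : ∀ k → suc k < h → high k < high (suc k)
      high-increasing k p = begin-strict
        top k * N + suc (σ° k + σ° (suc k))                  ≡⟨ regroup (top k * N) (σ° k) (σ° (suc k)) ⟩
        top k * N + σ° k + suc (σ° (suc k))                  <⟨ +-monoˡ-< _ (block< (top-increasing k p) (σ<N _) (σ° (2 + k))) ⟩
        top (suc k) * N + σ° (2 + k) + suc (σ° (suc k))      ≡⟨ regroup′ (top (suc k) * N) (σ° (suc k)) (σ° (2 + k)) ⟩
        top (suc k) * N + suc (σ° (suc k) + σ° (2 + k))      ∎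
        where
        open ≤-Reasoning
        regroup : ∀ a s t → a + suc (s + t) ≡ a + s + suc t
        regroup = solve-∀
        regroup′ : ∀ a s t → a + t + suc s ≡ a + suc (s + t)
        regroup′ = solve-∀

      low< : ∀ {a b} → a < b → b < h → low b < low a
      low< = stepwise _>_ (λ p q → <-trans q p) low low-decreasing

      high< : ∀ {a b} → a < b → b < h → high a < high b
      high< = stepwise _<_ <-trans high high-increasing

      low≤low₀ : ∀ {k} → k < h → low k ≤ low 0
      low≤low₀ {zero}  k<h = ≤-refl
      low≤low₀ {suc k} k<h = <⇒≤ (low< z<s k<h)

      high₀≤high : ∀ {k} → k < h → high 0 ≤ high k
      high₀≤high {zero}  k<h = ≤-refl
      high₀≤high {suc k} k<h = <⇒≤ (high< z<s k<h)

      low₀<high₀ : low 0 < high 0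
      low₀<high₀ = ≤-trans (≤-reflexive (sym (+-suc (level 0 * N) _)))
        (+-mono-≤ (*-monoˡ-≤ N (m≤m+n (level 0) (class 0))) (s≤s (m≤n+m _ (σ° 0))))

      low<high : ∀ {a b} → a < h → b < h → low a < high b
      low<high a<h b<h = <-≤-trans (≤-<-trans (low≤low₀ a<h) low₀<high₀) (high₀≤high b<h)

      high≤ : ∀ {k} → k < h → high k ≤ 2 * (h * 2) * N
      high≤ {k} k<h = ≤-trans (high≤last (m≤n⇒m<n∨m≡n (pred-mono-≤ k<h))) (begin
        top l * N + suc (σ° l + σ° (suc l))  ≤⟨ +-mono-≤ (*-monoˡ-≤ N (top≤ l (suc-pred h))) (+-mono-≤ (σ<N (l % h)) (<⇒≤ (σ<N (suc l % h)))) ⟩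
        h * 2 * N + (N + N)                  ≤⟨ +-monoʳ-≤ (h * 2 * N) (≤-trans (≤-reflexive (cong (N +_) (sym (+-identityʳ N)))) (*-monoˡ-≤ N (m≤n*m 2 h))) ⟩
        h * 2 * N + h * 2 * N                ≡⟨ regroup (h * 2) N ⟩
        2 * (h * 2) * N                      ∎)
        where
        open ≤-Reasoning
        l = pred h
        regroup : ∀ a b → a * b + a * b ≡ 2 * a * b
        regroup = solve-∀
        high≤last : k < l ⊎ k ≡ l → high k ≤ high l
        high≤last (inj₁ k<l)  = <⇒≤ (high< k<l (≤-reflexive (suc-pred h)))
        high≤last (inj₂ refl) = ≤-refl

      node-bound : ∀ e → node e < suc (2 * (h * 2) * N)
      node-bound (k , zero)  = s≤s (high≤ (toℕ<n k))
      node-bound (k , suc _) = s≤s (≤-trans (<⇒≤ (low<high (toℕ<n k) (toℕ<n k))) (high≤ (toℕ<n k)))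

      node-injective : ∀ e e′ → node e ≡ node e′ → e ≡ e′
      node-injective (k , zero) (k′ , zero) p with <-cmp (toℕ k) (toℕ k′)
      ... | tri< k<k′ _ _ = contradiction p (<⇒≢ (high< k<k′ (toℕ<n k′)))
      ... | tri≈ _ k≡k′ _ = cong (_, zero) (toℕ-injective k≡k′)
      ... | tri> _ _ k′<k = contradiction (sym p) (<⇒≢ (high< k′<k (toℕ<n k)))
      node-injective (k , zero) (k′ , suc zero) p = contradiction (sym p) (<⇒≢ (low<high (toℕ<n k′) (toℕ<n k)))
      node-injective (k , suc zero) (k′ , zero) p = contradiction p (<⇒≢ (low<high (toℕ<n k) (toℕ<n k′)))
      node-injective (k , suc zero) (k′ , suc zero) p with <-cmp (toℕ k) (toℕ k′)
      ... | tri< k<k′ _ _ = contradiction (sym p) (<⇒≢ (low< k<k′ (toℕ<n k′)))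
      ... | tri≈ _ k≡k′ _ = cong (_, suc zero) (toℕ-injective k≡k′)
      ... | tri> _ _ k′<k = contradiction p (<⇒≢ (low< k′<k (toℕ<n k)))

  private
    weightAt : Fin h × Fin 2 → ℕ
    weightAt (k , zero)  = toℕ k % h
    weightAt (k , suc _) = (2 + toℕ k) % h

    split : Fin (h * 2) → Fin h × Fin 2
    split = remQuot {h} 2

    split-injective : ∀ {j j′} → split j ≡ split j′ → j ≡ j′
    split-injective {j} {j′} p = trans (sym (combine-remQuot {h} 2 j)) (trans (cong (uncurry combine) p) (combine-remQuot {h} 2 j′))

    toℕ-high : (k : Fin h) → toℕ (combine k (zero {1})) ≡ 2 * toℕ k
    toℕ-high k = trans (toℕ-combine k zero) (+-identityʳ _)

    toℕ-low : (k : Fin h) → toℕ (combine k (suc (zero {0}))) ≡ suc (2 * toℕ k)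
    toℕ-low k = trans (toℕ-combine k (suc zero)) (+-comm (2 * toℕ k) 1)

    next-high : (k : Fin h) → nextPos (combine k (zero {1})) ≡ combine k (suc zero)
    next-high k = toℕ-injective (trans (toℕ-nextPos-< (combine k zero) (subst (λ u → suc u < h * 2) (sym (toℕ-high k)) 1+2k<2h))
                                       (trans (cong suc (toℕ-high k)) (sym (toℕ-low k))))
      where
      1+2k<2h : suc (2 * toℕ k) < h * 2
      1+2k<2h = subst₂ _≤_ (*-suc 2 (toℕ k)) (*-comm 2 h) (*-monoʳ-≤ 2 (toℕ<n k))

    next-low : (k : Fin h) → nextPos (combine k (suc (zero {0}))) ≡ combine (nextPos k) zero
    next-low k = toℕ-injective (trans (position (m≤n⇒m<n∨m≡n (toℕ<n k))) (sym (toℕ-high (nextPos k))))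
      where
      j = combine k (suc (zero {0}))
      1+j : suc (toℕ j) ≡ 2 + 2 * toℕ k
      1+j = cong suc (toℕ-low k)
      position : suc (toℕ k) < h ⊎ suc (toℕ k) ≡ h → toℕ (nextPos j) ≡ 2 * toℕ (nextPos k)
      position (inj₁ p) = trans (toℕ-nextPos-< j (subst (_< h * 2) (sym 1+j) (2k+2<2h p)))
        (trans 1+j (trans (sym (*-suc 2 (toℕ k))) (cong (2 *_) (sym (toℕ-nextPos-< k p)))))
      position (inj₂ p) = trans (toℕ-nextPos-≡ j (trans 1+j (trans (sym (*-suc 2 (toℕ k))) (trans (cong (2 *_) p) (*-comm 2 h)))))
        (cong (2 *_) (sym (toℕ-nextPos-≡ k p)))

    climb : ∀ σ k → high σ k ≡ low σ k + suc (class (2 * k) * N + σ (k % h))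
    climb σ k = regroup (level k) (class (2 * k)) N (σ (k % h)) (σ (suc k % h))
      where
      regroup : ∀ a b N s t → (a + b) * N + suc (s + t) ≡ a * N + t + suc (b * N + s)
      regroup = solve-∀

    climb-next : ∀ σ (k : Fin h) → high σ (toℕ (nextPos k)) ≡
                 low σ (toℕ k) + suc (class (suc (2 * toℕ k)) * N + σ ((2 + toℕ k) % h))
    climb-next σ k = from (m≤n⇒m<n∨m≡n (toℕ<n k))
      where
      K = toℕ k
      c = class (suc (2 * K))
      regroup : ∀ a b N s t → (a + b) * N + suc (s + t) ≡ a * N + s + suc (b * N + t)
      regroup = solve-∀
      from : suc K < h ⊎ suc K ≡ h → high σ (toℕ (nextPos k)) ≡ low σ K + suc (c * N + σ ((2 + K) % h))
      from (inj₁ p) = trans (cong (high σ) (toℕ-nextPos-< k p))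
        (trans (cong (λ u → u * N + suc (σ (suc K % h) + σ ((2 + K) % h))) (level-step K p))
               (regroup (level K) c N (σ (suc K % h)) (σ ((2 + K) % h))))
      from (inj₂ p) = trans (cong (high σ) (toℕ-nextPos-≡ k p))
        (trans (cong₂ (λ u v → u * N + suc v) (level-close K p) (cong₂ (λ a b → σ a + σ b) 0≡1+K 1≡2+K))
               (regroup (level K) c N (σ (suc K % h)) (σ ((2 + K) % h))))
        where
        0≡1+K : 0 % h ≡ suc K % h
        0≡1+K = sym (trans (cong (_% h) p) ([m+n]%n≡m%n 0 h))
        1≡2+K : 1 % h ≡ (2 + K) % h
        1≡2+K = sym (trans (cong (λ u → suc u % h) p) ([m+n]%n≡m%n 1 h))

    tailAt : (ℕ → ℕ) → Fin h × Fin 2 → ℕ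
    tailAt σ (k , _) = low σ (toℕ k)

    EdgeAt : (ℕ → ℕ) → ℕ → (e e′ : Fin h × Fin 2) → Set
    EdgeAt σ p e e′ = (node σ e ≡ tailAt σ e × node σ e′ ≡ tailAt σ e + d) ⊎ (node σ e′ ≡ tailAt σ e × node σ e ≡ tailAt σ e + d)
      where d = suc (class p * N + σ (weightAt e))

    edgeAt : ∀ σ j → EdgeAt σ (toℕ j) (split j) (split (nextPos j))
    edgeAt σ j with combine-surjective {h} {2} j
    ... | k , zero , refl rewrite next-high k | toℕ-high k =
      subst₂ (EdgeAt σ (2 * toℕ k)) (sym (remQuot-combine k zero)) (sym (remQuot-combine k (suc zero)))
        (inj₂ (refl , climb σ (toℕ k)))
    ... | k , suc zero , refl rewrite next-low k | toℕ-low k =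
      subst₂ (EdgeAt σ (suc (2 * toℕ k))) (sym (remQuot-combine k (suc zero))) (sym (remQuot-combine (nextPos k) zero))
        (inj₁ (refl , climb-next σ k))

    2%h≡2 : 2 % h ≡ 2
    2%h≡2 = m<n⇒m%n≡m 2<h

    -- This is where h > 2 enters: the two edges that share the tail x_k have weights k and k + 2
    -- modulo h. Hence edges of equal weight have different tails.
    distinct-weights : ∀ k → k % h ≢ (2 + k) % h
    distinct-weights k p = 0≢1+n (trans (sym (m<n⇒m%n≡m (<-trans z<s 2<h))) (trans (%-cancelʳ-+ h 0 2 k p) 2%h≡2))

    weights-separate : ∀ e e′ → proj₁ e ≡ proj₁ e′ → weightAt e ≡ weightAt e′ → e ≡ e′
    weights-separate (k , zero)     (_ , zero)     refl p = refl
    weights-separate (k , zero)     (_ , suc zero) refl p = contradiction p (distinct-weights (toℕ k))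
    weights-separate (k , suc zero) (_ , zero)     refl p = contradiction (sym p) (distinct-weights (toℕ k))
    weights-separate (k , suc zero) (_ , suc zero) refl p = refl

    1+%-injective : (k k′ : Fin h) → suc (toℕ k) % h ≡ suc (toℕ k′) % h → k ≡ k′
    1+%-injective k k′ p = toℕ-injective (%-injective h (toℕ k) (toℕ k′) (toℕ<n k) (toℕ<n k′)
      (%-cancelʳ-+ h (toℕ k) (toℕ k′) 1 (subst₂ (λ u v → u % h ≡ v % h) (+-comm 1 (toℕ k)) (+-comm 1 (toℕ k′)) p)))

    %h<2h : ∀ k → k % h < h * 2
    %h<2h k = <-≤-trans (m%n<n k h) (m≤m*n h 2)

    weightAt< : ∀ e → weightAt e < h * 2
    weightAt< (k , zero)  = %h<2h (toℕ k)
    weightAt< (k , suc _) = %h<2h (2 + toℕ k)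

    cancel-levels : ∀ a b s t s′ t′ → a + s + (b + t) ≡ b + s′ + (a + t′) → s + t ≡ s′ + t′
    cancel-levels a b s t s′ t′ p = +-cancelˡ-≡ (a + b) (s + t) (s′ + t′)
      (trans (sym (regroup a b s t)) (trans p (regroup′ a b s′ t′)))
      where
      regroup : ∀ a b s t → a + s + (b + t) ≡ a + b + (s + t)
      regroup = solve-∀
      regroup′ : ∀ a b s t → b + s + (a + t) ≡ a + b + (s + t)
      regroup′ = solve-∀

  zigzag-scheme : Scheme (h * 2) N
  zigzag-scheme = record
    { class         = class ∘ toℕ
    ; weight        = weightAt ∘ split
    ; vert          = λ σ → node σ ∘ split
    ; tail          = λ σ → tailAt σ ∘ split
    ; fold          = fold ∘ toℕ
    ; fold<         = fold< ∘ toℕ<n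
    ; fold-inj      = λ {j} {j′} p → toℕ-injective
                        (trans (sym (unfold-fold (toℕ<n j))) (trans (cong unfold p) (unfold-fold (toℕ<n j′))))
    ; fold-onto     = λ {a} a<2h → fromℕ< (unfold< a<2h) , trans (cong fold (toℕ-fromℕ< (unfold< a<2h))) (fold-unfold a<2h)
    ; class-fold    = λ j → class-fold (toℕ<n j)
    ; weight<       = weightAt< ∘ split
    ; vert<         = λ σ<N → node-bound _ σ<N ∘ split
    ; vert-inj      = λ σ<N p → split-injective (node-injective _ σ<N _ _ p)
    ; tail≤         = λ {σ} σ<N j → ≤-trans (low≤low₀ σ σ<N (toℕ<n (proj₁ (split j))))
                        (≤-trans (<⇒≤ (block< {level 0} ≤-refl (σ<N _) 0)) (≤-trans (≤-reflexive (+-identityʳ _)) (*-monoˡ-≤ N level<)))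
    ; edge          = edgeAt
    ; tail-separate = λ {σ} {τ} {j} {j′} j≢j′ w≡w′ _ p →
        let k = proj₁ (split j) ; k′ = proj₁ (split j′)
        -- The tails x_k and x_k′ have the offsets σ (k+1) and σ (k′+1), and their blocks are the
        -- same for σ and τ; so comparing tails compares the offsets at these two weights.
        in suc (toℕ k) % h , suc (toℕ k′) % h , %h<2h (suc (toℕ k)) , %h<2h (suc (toℕ k′)) ,
           (λ q → j≢j′ (split-injective (weights-separate (split j) (split j′) (1+%-injective k k′ q) w≡w′))) ,
           cancel-levels (level (toℕ k) * N) (level (toℕ k′) * N) _ _ _ _ p
    }

-- Orders of the classes with alternating sum zero.

-- fold runs through 0, …, ℓ − 1 in increasing order, except that g is postponed to the end.
module Gap {ℓ g : ℕ} (1+g<ℓ : suc g < ℓ) where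

  fold : ℕ → ℕ
  fold p with p <? g | suc p <? ℓ
  ... | yes _ | _     = p
  ... | no _  | yes _ = suc p
  ... | no _  | no _  = g

  unfold : ℕ → ℕ
  unfold a with <-cmp a g
  ... | tri< _ _ _ = a
  ... | tri≈ _ _ _ = pred ℓ
  ... | tri> _ _ _ = pred a

  fold-below : ∀ {p} → p < g → fold p ≡ p
  fold-below {p} p<g with p <? g | suc p <? ℓ
  ... | yes _  | _ = refl
  ... | no p≮g | _ = contradiction p<g p≮g

  fold-above : ∀ {p} → g ≤ p → suc p < ℓ → fold p ≡ suc p
  fold-above {p} g≤p 1+p<ℓ with p <? g | suc p <? ℓ
  ... | yes p<g | _        = contradiction p<g (≤⇒≯ g≤p)
  ... | no _    | yes _    = refl
  ... | no _    | no 1+p≮ℓ = contradiction 1+p<ℓ 1+p≮ℓ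

  fold-last : ∀ {p} → suc p ≡ ℓ → fold p ≡ g
  fold-last {p} refl with p <? g | suc p <? ℓ
  ... | yes p<g | _         = contradiction p<g (<⇒≯ (s<s⁻¹ 1+g<ℓ))
  ... | no _    | yes 1+p<ℓ = contradiction 1+p<ℓ (n≮n _)
  ... | no _    | no _      = refl

  data Region (p : ℕ) : Set where
    below : p < g → Region p
    above : g ≤ p → suc p < ℓ → Region p
    last  : suc p ≡ ℓ → Region p

  region : ∀ {p} → p < ℓ → Region p
  region {p} p<ℓ with p <? g | m≤n⇒m<n∨m≡n p<ℓ
  ... | yes p<g | _          = below p<g
  ... | no p≮g  | inj₁ 1+p<ℓ = above (≮⇒≥ p≮g) 1+p<ℓ
  ... | no p≮g  | inj₂ 1+p≡ℓ = last 1+p≡ℓ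

  unfold-below : ∀ {a} → a < g → unfold a ≡ a
  unfold-below {a} a<g with <-cmp a g
  ... | tri< _ _ _   = refl
  ... | tri≈ a≮g _ _ = contradiction a<g a≮g
  ... | tri> a≮g _ _ = contradiction a<g a≮g

  unfold-gap : unfold g ≡ pred ℓ
  unfold-gap with <-cmp g g
  ... | tri< _ g≢g _ = contradiction refl g≢g
  ... | tri≈ _ _ _   = refl
  ... | tri> _ g≢g _ = contradiction refl g≢g

  unfold-above : ∀ {a} → g ≤ a → unfold (suc a) ≡ a
  unfold-above {a} g≤a with <-cmp (suc a) g
  ... | tri< 1+a<g _ _ = contradiction (s≤s g≤a) (<⇒≯ 1+a<g)
  ... | tri≈ _ 1+a≡g _ = contradiction (sym 1+a≡g) (<⇒≢ (s≤s g≤a))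
  ... | tri> _ _ _     = refl

  fold< : ∀ {p} → p < ℓ → fold p < ℓ
  fold< p<ℓ with region p<ℓ
  ... | below p<g       = subst (_< ℓ) (sym (fold-below p<g)) p<ℓ
  ... | above g≤p 1+p<ℓ = subst (_< ℓ) (sym (fold-above g≤p 1+p<ℓ)) 1+p<ℓ
  ... | last 1+p≡ℓ      = subst (_< ℓ) (sym (fold-last 1+p≡ℓ)) (<-trans (n<1+n g) 1+g<ℓ)

  unfold-fold : ∀ {p} → p < ℓ → unfold (fold p) ≡ p
  unfold-fold p<ℓ with region p<ℓ
  ... | below p<g       = trans (cong unfold (fold-below p<g)) (unfold-below p<g)
  ... | above g≤p 1+p<ℓ = trans (cong unfold (fold-above g≤p 1+p<ℓ)) (unfold-above g≤p)
  ... | last refl       = trans (cong unfold (fold-last refl)) unfold-gap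

  unfold< : ∀ {a} → a < ℓ → unfold a < ℓ
  unfold< {a} a<ℓ with <-cmp a g
  ... | tri< _ _ _ = a<ℓ
  ... | tri≈ _ _ _ = pred< 1+g<ℓ
    where
    pred< : ∀ {a b} → a < b → pred b < b
    pred< {b = suc b} _ = n<1+n b
  ... | tri> _ _ _ = ≤-<-trans pred[n]≤n a<ℓ

  fold-unfold : ∀ {a} → a < ℓ → fold (unfold a) ≡ a
  fold-unfold {a} a<ℓ with <-cmp a g
  ... | tri< a<g _ _  = fold-below a<g
  ... | tri≈ _ refl _ = fold-last (suc-pred ℓ {{>-nonZero (<-trans z<s 1+g<ℓ)}})
  ... | tri> _ _ g<a  = above-gap g<a a<ℓ
    where
    above-gap : ∀ {a} → g < a → a < ℓ → fold (pred a) ≡ a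
    above-gap {suc a} g<a a<ℓ = fold-above (s≤s⁻¹ g<a) a<ℓ

  fold-step : ∀ {p} → suc p ≢ g → 2 + p < ℓ → fold (suc p) ≡ suc (fold p)
  fold-step {p} 1+p≢g 2+p<ℓ with <-cmp (suc p) g
  ... | tri< 1+p<g _ _ = trans (fold-below 1+p<g) (cong suc (sym (fold-below (<-trans (n<1+n p) 1+p<g))))
  ... | tri≈ _ 1+p≡g _ = contradiction 1+p≡g 1+p≢g
  ... | tri> _ _ g≤p   = trans (fold-above (≤-trans (n≤1+n g) g≤p) 2+p<ℓ)
                               (cong suc (sym (fold-above (s≤s⁻¹ g≤p) (<-trans (n<1+n _) 2+p<ℓ))))

  fold≤ : ∀ {p} → suc p < ℓ → fold p ≤ suc p
  fold≤ {p} 1+p<ℓ with region (<-trans (n<1+n p) 1+p<ℓ)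
  ... | below p<g   = ≤-trans (≤-reflexive (fold-below p<g)) (n≤1+n p)
  ... | above g≤p _ = ≤-reflexive (fold-above g≤p 1+p<ℓ)
  ... | last 1+p≡ℓ  = contradiction 1+p≡ℓ (<⇒≢ 1+p<ℓ)

  fold-increasing : ∀ p → 2 + p < ℓ → fold p < fold (suc p)
  fold-increasing p 2+p<ℓ with suc p ≟ g
  ... | no 1+p≢g  = ≤-reflexive (sym (fold-step 1+p≢g 2+p<ℓ))
  ... | yes 1+p≡g = subst₂ _<_ (sym (fold-below (≤-reflexive 1+p≡g))) (sym (fold-above (≤-reflexive (sym 1+p≡g)) 2+p<ℓ))
                           (<-trans (n<1+n p) (n<1+n (suc p)))

n<1+n*2 : ∀ n → n < suc (n * 2)
n<1+n*2 n = s≤s (m≤m*n n 2)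

2n+2≡ : ∀ n → 2 + 2 * n ≡ suc n * 2
2n+2≡ = solve-∀

-- Since class 0 is 0, the classes before the last have alternating sum equal to the total of the g
-- steps from position 2k + 1 to 2k + 2. As g is odd, the jump over g falls between positions 2k and
-- 2k + 1, so all these steps are 1. Their total g is the class put last.
zigzag-even : ∀ g q → suc g ≡ 2 * q → 0 < g → Zigzag (suc g)
zigzag-even g q 1+g≡2q 0<g = record
  { level       = g ∸_
  ; class       = fold
  ; fold        = fold
  ; unfold      = unfold
  ; class-step  = fold-increasing
  ; level-step  = level-step
  ; level-close = level-close
  ; level<      = <-trans (n<1+n*2 g) (n<1+n _)
  ; top≤        = top≤
  ; fold<       = fold<
  ; unfold<     = unfold<
  ; unfold-fold = unfold-fold
  ; fold-unfold = fold-unfold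
  ; class-fold  = λ _ → inj₁ refl
  }
  where
  open Gap {suc g * 2} {g} (s≤s (n<1+n*2 g))
  level-step : ∀ k → suc k < suc g → g ∸ suc k + fold (2 * suc k) ≡ g ∸ k + fold (suc (2 * k))
  level-step k 1+k<1+g = begin
    g ∸ suc k + fold (2 * suc k)               ≡⟨ cong (λ u → g ∸ suc k + fold u) (*-suc 2 k) ⟩
    g ∸ suc k + fold (2 + 2 * k)               ≡⟨ cong (g ∸ suc k +_) (fold-step odd-gap (2k+3<2h 1+k<1+g)) ⟩
    g ∸ suc k + suc (fold (suc (2 * k)))       ≡⟨ +-suc (g ∸ suc k) _ ⟩
    suc (g ∸ suc k) + fold (suc (2 * k))       ≡⟨ cong (_+ fold (suc (2 * k))) (+-∸-assoc 1 (s≤s⁻¹ 1+k<1+g)) ⟨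
    g ∸ k + fold (suc (2 * k))                 ∎
    where
    open ≡-Reasoning
    odd-gap : 2 + 2 * k ≢ g
    odd-gap p = even≢odd q (suc k) (trans (sym 1+g≡2q) (cong suc (trans (sym p) (sym (*-suc 2 k)))))
  level-close : ∀ k → suc k ≡ suc g → g + fold 0 ≡ g ∸ k + fold (suc (2 * k))
  level-close k refl = begin
    g + fold 0                 ≡⟨ cong (g +_) (fold-below 0<g) ⟩
    g + 0                      ≡⟨ +-comm g 0 ⟩
    g                          ≡⟨ fold-last (2n+2≡ g) ⟨
    fold (suc (2 * g))         ≡⟨ cong (_+ fold (suc (2 * g))) (n∸n≡0 g) ⟨
    g ∸ g + fold (suc (2 * g)) ∎ where open ≡-Reasoning
  top≤ : ∀ k → suc k ≡ suc g → g ∸ k + fold (2 * k) ≤ suc g * 2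
  top≤ k refl = subst (λ u → u + fold (2 * g) ≤ suc g * 2) (sym (n∸n≡0 g))
    (<⇒≤ (fold< (≤-trans (n≤1+n _) (≤-reflexive (2n+2≡ g)))))

-- Here the alternating sum of the classes 0, …, ℓ − 1 cannot vanish, for parity reasons; replacing
-- the class ℓ − 1 by the opposite class ℓ repairs this.
zigzag-odd : ∀ q → 0 < q → Zigzag (suc (2 * q))
zigzag-odd q 0<q = record
  { level       = level
  ; class       = class
  ; fold        = fold
  ; unfold      = unfold
  ; class-step  = class-step
  ; level-step  = level-step
  ; level-close = level-close
  ; level<      = level<
  ; top≤        = λ k 1+k≡h → ≤-reflexive (trans (level+class (≤-reflexive 1+k≡h)) (last-top 1+k≡h))
  ; fold<       = fold<
  ; unfold<     = unfold<
  ; unfold-fold = unfold-fold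
  ; fold-unfold = fold-unfold
  ; class-fold  = class-fold
  }
  where
  h = suc (2 * q)
  ℓ = h * 2
  h+h≡ℓ : h + h ≡ ℓ
  h+h≡ℓ = trans (cong (h +_) (sym (+-identityʳ h))) (*-comm 2 h)
  2+h<ℓ : 2 + h < ℓ
  2+h<ℓ = subst (3 + h ≤_) h+h≡ℓ (+-monoˡ-≤ h (s≤s (*-monoʳ-≤ 2 0<q)))
  last-top : ∀ {k} → suc k ≡ h → suc h + k ≡ ℓ
  last-top {k} 1+k≡h = trans (sym (+-suc h k)) (trans (cong (h +_) 1+k≡h) h+h≡ℓ)
  last-position : ∀ {k} → suc k ≡ h → 2 + 2 * k ≡ ℓ
  last-position {k} 1+k≡h = trans (2n+2≡ k) (cong (_* 2) 1+k≡h)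
  -- The h - 1 steps from position 2k + 1 to 2k + 2 give 1 each; the jump over the gap, at an even
  -- position as h is odd, and the raised class ℓ add 1 each. The total h + 1 is the class needed
  -- last, hence the gap.
  open Gap {ℓ} {suc h} 2+h<ℓ

  class : ℕ → ℕ
  class p with 2 + p ≟ ℓ
  ... | yes _ = ℓ
  ... | no _  = fold p

  class-top : ∀ {p} → 2 + p ≡ ℓ → class p ≡ ℓ
  class-top {p} 2+p≡ℓ with 2 + p ≟ ℓ
  ... | yes _    = refl
  ... | no 2+p≢ℓ = contradiction 2+p≡ℓ 2+p≢ℓ

  class≡fold : ∀ {p} → 2 + p ≢ ℓ → class p ≡ fold p
  class≡fold {p} 2+p≢ℓ with 2 + p ≟ ℓ
  ... | yes 2+p≡ℓ = contradiction 2+p≡ℓ 2+p≢ℓ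
  ... | no _      = refl

  class-fold : ∀ {p} → p < ℓ → class p ≡ fold p ⊎ class p + fold p + 1 ≡ 2 * ℓ
  class-fold {p} p<ℓ with 2 + p ≟ ℓ
  ... | no _      = inj₁ refl
  ... | yes 2+p≡ℓ = inj₂ (begin
      ℓ + fold p + 1   ≡⟨ +-assoc ℓ (fold p) 1 ⟩
      ℓ + (fold p + 1) ≡⟨ cong (λ u → ℓ + (u + 1)) (fold-above (s≤s⁻¹ (s≤s⁻¹ (subst (3 + h ≤_) (sym 2+p≡ℓ) 2+h<ℓ))) (≤-reflexive 2+p≡ℓ)) ⟩
      ℓ + (suc p + 1)  ≡⟨ cong (ℓ +_) (trans (+-comm (suc p) 1) 2+p≡ℓ) ⟩
      ℓ + ℓ            ≡⟨ cong (ℓ +_) (+-identityʳ ℓ) ⟨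
      2 * ℓ            ∎) where open ≡-Reasoning

  class-step : ∀ p → 2 + p < ℓ → class p < class (suc p)
  class-step p 2+p<ℓ = subst (_< class (suc p)) (sym (class≡fold (<⇒≢ 2+p<ℓ))) fold<class
    where
    fold<class : fold p < class (suc p)
    fold<class with 3 + p ≟ ℓ
    ... | yes _ = fold< (<-trans (n<1+n p) (<-trans (n<1+n _) 2+p<ℓ))
    ... | no _  = fold-increasing p 2+p<ℓ

  class-even-step : ∀ {k} → suc k < h → class (suc (2 * k)) ≡ suc (class (2 * k))
  class-even-step {k} 1+k<h = trans (class≡fold (<⇒≢ (2k+3<2h 1+k<h)))
    (trans (fold-step even-gap (2k+2<2h 1+k<h)) (cong suc (sym (class≡fold (<⇒≢ (2k+2<2h 1+k<h))))))
    where
    even-gap : suc (2 * k) ≢ suc h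
    even-gap p = even≢odd k q (suc-injective p)

  class≤ : ∀ {k} → k < h → class (2 * k) ≤ suc h + k
  class≤ {k} k<h with m≤n⇒m<n∨m≡n k<h
  ... | inj₁ 1+k<h = begin
      class (2 * k)  ≡⟨ class≡fold (<⇒≢ (2k+2<2h 1+k<h)) ⟩
      fold (2 * k)   ≤⟨ fold≤ (<-trans (n<1+n _) (2k+2<2h 1+k<h)) ⟩
      suc (2 * k)    ≡⟨ cong (λ u → suc (k + u)) (+-identityʳ k) ⟩
      suc (k + k)    ≤⟨ s≤s (+-monoˡ-≤ k (<⇒≤ k<h)) ⟩
      suc h + k      ∎ where open ≤-Reasoning
  ... | inj₂ 1+k≡h = ≤-reflexive (trans (class-top (last-position 1+k≡h)) (sym (last-top 1+k≡h)))

  -- Solved from the requirement that y_k have block number h + 1 + k, rising by one at each step;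
  -- `class≤` makes the truncated subtraction exact.
  level : ℕ → ℕ
  level k = suc h + k ∸ class (2 * k)

  level+class : ∀ {k} → k < h → level k + class (2 * k) ≡ suc h + k
  level+class k<h = m∸n+n≡m (class≤ k<h)

  level-step : ∀ k → suc k < h → level (suc k) + class (2 * suc k) ≡ level k + class (suc (2 * k))
  level-step k 1+k<h = begin
    level (suc k) + class (2 * suc k)  ≡⟨ level+class 1+k<h ⟩
    suc h + suc k                      ≡⟨ +-suc (suc h) k ⟩
    suc (suc h + k)                    ≡⟨ cong suc (level+class (<-trans (n<1+n k) 1+k<h)) ⟨
    suc (level k + class (2 * k))      ≡⟨ +-suc (level k) _ ⟨
    level k + suc (class (2 * k))      ≡⟨ cong (level k +_) (class-even-step 1+k<h) ⟨
    level k + class (suc (2 * k))      ∎ where open ≡-Reasoning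

  level-close : ∀ k → suc k ≡ h → level 0 + class 0 ≡ level k + class (suc (2 * k))
  level-close k 1+k≡h = begin
    level 0 + class 0              ≡⟨ level+class z<s ⟩
    suc h + 0                      ≡⟨ +-identityʳ (suc h) ⟩
    suc h                          ≡⟨ fold-last (last-position 1+k≡h) ⟨
    fold (suc (2 * k))             ≡⟨ class≡fold (λ p → 1+n≢n (trans p (sym (last-position 1+k≡h)))) ⟨
    class (suc (2 * k))            ≡⟨ cong (_+ class (suc (2 * k))) last-level ⟨
    level k + class (suc (2 * k))  ∎
    where
    open ≡-Reasoning
    last-level : level k ≡ 0
    last-level = trans (cong₂ _∸_ (last-top 1+k≡h) (class-top (last-position 1+k≡h))) (n∸n≡0 ℓ)

  level< : level 0 < ℓ
  level< = begin-strict
    level 0            ≤⟨ m≤m+n (level 0) (class 0) ⟩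
    level 0 + class 0  ≡⟨ level+class z<s ⟩
    suc h + 0          ≡⟨ +-identityʳ (suc h) ⟩
    suc h              <⟨ <-trans (n<1+n (suc h)) 2+h<ℓ ⟩
    ℓ                  ∎ where open ≤-Reasoning

-- Cycles of length 4.

module _ (N : ℕ) .{{_ : NonZero N}} where

  -- In an alternating 4-cycle, edges of equal weight would be adjacent, hence in a fixed relative
  -- position; so the signs are ++−− instead of +−+−.
  quadrilateral : Scheme 4 N
  quadrilateral = record
    { class         = toℕ ∘ fold
    ; weight        = weight
    ; vert          = vert
    ; tail          = tail
    ; fold          = toℕ ∘ fold
    ; fold<         = λ j → toℕ<n (fold j)
    ; fold-inj      = λ {j} {j′} p → fold-inj j j′ (toℕ-injective p)
    ; fold-onto     = fold-onto
    ; class-fold    = λ _ → inj₁ refl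
    ; weight<       = weight<
    ; vert<         = λ σ<N → vert< _ σ<N
    ; vert-inj      = λ σ<N {j} {j′} → vert-inj _ σ<N j j′
    ; tail≤         = λ σ<N → tail≤ _ σ<N
    ; edge          = edge
    ; tail-separate = λ {σ} {τ} {j} {j′} j≢j′ w≡w′ p q →
        let p₀ , p₁ = separate σ τ j j′ j≢j′ w≡w′ p q
        in 1 , 0 , s<s z<s , z<s , (λ ()) , trans (cong₂ _+_ p₁ (sym p₀)) (+-comm (τ 1) (σ 0))
    }
    where
    -- The class order 0, 3, 1, 2 fits the signs ++-- because 0 + 3 = 1 + 2.
    fold : Fin 4 → Fin 4
    fold 0F = 0F
    fold 1F = 3F
    fold 2F = 1F
    fold 3F = 2F

    unfold : Fin 4 → Fin 4
    unfold 0F = 0F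
    unfold 1F = 2F
    unfold 2F = 3F
    unfold 3F = 1F

    unfold-fold : ∀ j → unfold (fold j) ≡ j
    unfold-fold 0F = refl
    unfold-fold 1F = refl
    unfold-fold 2F = refl
    unfold-fold 3F = refl

    fold-unfold : ∀ j → fold (unfold j) ≡ j
    fold-unfold 0F = refl
    fold-unfold 1F = refl
    fold-unfold 2F = refl
    fold-unfold 3F = refl

    fold-inj : ∀ j j′ → fold j ≡ fold j′ → j ≡ j′
    fold-inj j j′ p = trans (sym (unfold-fold j)) (trans (cong unfold p) (unfold-fold j′))

    fold-onto : ∀ {a} → a < 4 → Σ (Fin 4) λ j → toℕ (fold j) ≡ a
    fold-onto a<4 = unfold (fromℕ< a<4) , trans (cong toℕ (fold-unfold (fromℕ< a<4))) (toℕ-fromℕ< a<4)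

    weight : Fin 4 → ℕ
    weight 0F = 0
    weight 1F = 1
    weight 2F = 0
    weight 3F = 1

    weight< : ∀ j → weight j < 4
    weight< 0F = z<s
    weight< 1F = s<s z<s
    weight< 2F = z<s
    weight< 3F = s<s z<s

    vert tail : (ℕ → ℕ) → Fin 4 → ℕ
    vert σ 0F = 0
    vert σ 1F = suc (σ 0)
    vert σ 2F = suc (σ 0) + suc (3 * N + σ 1)
    vert σ 3F = suc (2 * N + σ 1)
    tail σ 0F = 0
    tail σ 1F = suc (σ 0)
    tail σ 2F = suc (2 * N + σ 1)
    tail σ 3F = 0

    edge : ∀ σ j → (vert σ j ≡ tail σ j × vert σ (nextPos j) ≡ tail σ j + suc (toℕ (fold j) * N + σ (weight j))) ⊎
                   (vert σ (nextPos j) ≡ tail σ j × vert σ j ≡ tail σ j + suc (toℕ (fold j) * N + σ (weight j)))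
    edge σ 0F = inj₁ (refl , refl)
    edge σ 1F = inj₁ (refl , refl)
    edge σ 2F = inj₂ (refl , regroup N (σ 0) (σ 1))
      where
      regroup : ∀ N s t → suc s + suc (3 * N + t) ≡ suc (2 * N + t) + suc (1 * N + s)
      regroup = solve-∀
    edge σ 3F = inj₂ (refl , refl)

    module _ (σ : ℕ → ℕ) (σ<N : ∀ k → σ k < N) where
      v₁≤N : suc (σ 0) ≤ N
      v₁≤N = σ<N 0

      v₁<v₃ : vert σ 1F < vert σ 3F
      v₁<v₃ = s≤s (≤-trans v₁≤N (≤-trans (m≤m+n N (1 * N)) (m≤m+n (2 * N) (σ 1))))

      v₃<v₂ : vert σ 3F < vert σ 2F
      v₃<v₂ = s≤s (≤-trans (s≤s (+-monoˡ-≤ (σ 1) (*-monoˡ-≤ N (n≤1+n 2)))) (m≤n+m _ (σ 0)))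

      v₃≤3N : vert σ 3F ≤ 3 * N
      v₃≤3N = begin
        suc (2 * N + σ 1) ≡⟨ +-suc (2 * N) (σ 1) ⟨
        2 * N + suc (σ 1) ≤⟨ +-monoʳ-≤ (2 * N) (σ<N 1) ⟩
        2 * N + N         ≡⟨ +-comm (2 * N) N ⟩
        3 * N             ∎ where open ≤-Reasoning

      v₂≤8N : vert σ 2F ≤ 8 * N
      v₂≤8N = begin
        suc (σ 0) + suc (3 * N + σ 1)   ≡⟨ cong (suc (σ 0) +_) (+-suc (3 * N) (σ 1)) ⟨
        suc (σ 0) + (3 * N + suc (σ 1)) ≤⟨ +-mono-≤ v₁≤N (+-monoʳ-≤ (3 * N) (σ<N 1)) ⟩
        N + (3 * N + N)                 ≡⟨ regroup N ⟩
        5 * N                           ≤⟨ *-monoˡ-≤ N (m≤m+n 5 3) ⟩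
        8 * N                           ∎
        where
        open ≤-Reasoning
        regroup : ∀ N → N + (3 * N + N) ≡ 5 * N
        regroup = solve-∀

      vert< : ∀ j → vert σ j < 1 + 8 * N
      vert< 0F = z<s
      vert< 1F = s≤s (≤-trans (<⇒≤ (<-trans v₁<v₃ v₃<v₂)) v₂≤8N)
      vert< 2F = s≤s v₂≤8N
      vert< 3F = s≤s (≤-trans (<⇒≤ v₃<v₂) v₂≤8N)

      tail≤ : ∀ j → tail σ j ≤ 4 * N
      tail≤ 0F = z≤n
      tail≤ 1F = ≤-trans v₁≤N (m≤m+n N (3 * N))
      tail≤ 2F = ≤-trans v₃≤3N (*-monoˡ-≤ N (n≤1+n 3))
      tail≤ 3F = z≤n

      vert-inj : ∀ j j′ → vert σ j ≡ vert σ j′ → j ≡ j′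
      vert-inj 0F 0F p = refl
      vert-inj 1F 1F p = refl
      vert-inj 2F 2F p = refl
      vert-inj 3F 3F p = refl
      vert-inj 1F 2F p = contradiction p (<⇒≢ (<-trans v₁<v₃ v₃<v₂))
      vert-inj 2F 1F p = contradiction (sym p) (<⇒≢ (<-trans v₁<v₃ v₃<v₂))
      vert-inj 1F 3F p = contradiction p (<⇒≢ v₁<v₃)
      vert-inj 3F 1F p = contradiction (sym p) (<⇒≢ v₁<v₃)
      vert-inj 2F 3F p = contradiction (sym p) (<⇒≢ v₃<v₂)
      vert-inj 3F 2F p = contradiction p (<⇒≢ v₃<v₂)
      vert-inj 0F 1F ()
      vert-inj 0F 2F ()
      vert-inj 0F 3F ()
      vert-inj 1F 0F ()
      vert-inj 2F 0F ()
      vert-inj 3F 0F ()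

    -- Edges of equal weight are opposite. The tails of edges 0 and 2, of weight 0, differ by a
    -- constant plus σ 1; those of edges 1 and 3, of weight 1, by a constant plus σ 0. So the offset
    -- that the weights leave open is read off from the tails.
    separate : ∀ σ τ j j′ → j ≢ j′ → weight j ≡ weight j′ → σ (weight j) ≡ τ (weight j) →
               tail σ j + tail τ j′ ≡ tail σ j′ + tail τ j → σ 0 ≡ τ 0 × σ 1 ≡ τ 1
    separate σ τ 0F 2F _ _ p₀ q = p₀ , +-cancelˡ-≡ (2 * N) _ _ (suc-injective (trans (sym (+-identityʳ _)) (sym q)))
    separate σ τ 2F 0F _ _ p₀ q = p₀ , +-cancelˡ-≡ (2 * N) _ _ (suc-injective (trans (sym (+-identityʳ _)) q))
    separate σ τ 1F 3F _ _ p₁ q = suc-injective (trans (sym (+-identityʳ _)) q) , p₁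
    separate σ τ 3F 1F _ _ p₁ q = suc-injective (trans (sym (+-identityʳ _)) (sym q)) , p₁
    separate σ τ 0F 0F j≢j′ _ _ _ = contradiction refl j≢j′
    separate σ τ 1F 1F j≢j′ _ _ _ = contradiction refl j≢j′
    separate σ τ 2F 2F j≢j′ _ _ _ = contradiction refl j≢j′
    separate σ τ 3F 3F j≢j′ _ _ _ = contradiction refl j≢j′
    separate σ τ 0F 1F _ () _ _
    separate σ τ 0F 3F _ () _ _
    separate σ τ 1F 0F _ () _ _
    separate σ τ 1F 2F _ () _ _
    separate σ τ 2F 1F _ () _ _
    separate σ τ 2F 3F _ () _ _
    separate σ τ 3F 0F _ () _ _
    separate σ τ 3F 2F _ () _ _

-- Choice of the scheme and of the number of systems.

zigzag-by-parity : ∀ {h} r q → r < 2 → h ≡ r + 2 * q → 2 < h → Zigzag h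
zigzag-by-parity 0 zero    _ refl ()
zigzag-by-parity 0 (suc q) _ refl 2<h = zigzag-even _ (suc q) refl (s<s⁻¹ (<-trans (n<1+n 1) 2<h))
zigzag-by-parity 1 zero    _ refl (s≤s ())
zigzag-by-parity 1 (suc q) _ refl _ = zigzag-odd (suc q) z<s
zigzag-by-parity (suc (suc _)) _ (s≤s (s≤s ())) _ _

zigzag : ∀ {h} → 2 < h → Zigzag h
zigzag {h} = zigzag-by-parity (h % 2) (h / 2) (m%n<n h 2)
  (trans (m≡m%n+[m/n]*n h 2) (cong (h % 2 +_) (*-comm (h / 2) 2)))

scheme : ∀ h N .{{_ : NonZero N}} → 2 ≤ h → Scheme (h * 2) N
scheme h N 2≤h with m≤n⇒m<n∨m≡n 2≤h
... | inj₁ 2<h  = zigzag-scheme h N {{>-nonZero (<-trans z<s 2<h)}} 2<h (zigzag 2<h)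
... | inj₂ refl = quadrilateral N

theorem3 : (ℓ n N : ℕ) → 4 ≤ ℓ → 2 ∣ ℓ → n ≡ 1 + 2 * ℓ * N →
    ((m : ℕ) → MOCyclicFamily ℓ n m → MOFamily ℓ n m) ×
    Σ ℕ (λ m → MOCyclicFamily ℓ n m ×
    ((ℓ % 4 ≡ 0 → N ≤ suc m * (4 * ℓ ∸ 2)) ×
    (ℓ % 4 ≡ 2 → N ≤ suc m * (24 * ℓ ∸ 18))))
theorem3 ℓ n zero _ _ _ =
  (λ _ (F , _ , orthogonal) → F , orthogonal) ,
  -- For N = 0 the lower bound is -1, and the empty family meets it.
  0 , ((λ ()) , (λ ()) , (λ ())) , (λ _ → z≤n) , (λ _ → z≤n)
theorem3 ℓ n N@(suc _) 4≤ℓ (divides h refl) refl =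
  (λ _ (F , _ , orthogonal) → F , orthogonal) ,
  m , Family.family (scheme h N 2≤h) m mℓ≤N , (λ _ → N≤) , (λ _ → ≤-trans N≤ (*-monoʳ-≤ (suc m) d≤))
  where
  2≤h : 2 ≤ h
  2≤h = *-cancelʳ-≤ 2 h 2 4≤ℓ
  d = 4 * ℓ ∸ 2
  ℓ≤d : ℓ ≤ d
  ℓ≤d = m+n≤o⇒m≤o∸n ℓ (+-monoʳ-≤ ℓ (≤-trans (≤-trans (s≤s (s≤s z≤n)) 4≤ℓ) (m≤m+n ℓ _)))
  instance
    d≢0 : NonZero d
    d≢0 = >-nonZero (≤-trans (≤-trans z<s 4≤ℓ) ℓ≤d)
  d≤ : d ≤ 24 * ℓ ∸ 18
  d≤ = ≤-trans (m∸n≤m (4 * ℓ) 2) (m+n≤o⇒m≤o∸n (4 * ℓ) (begin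
    4 * ℓ + 18      ≤⟨ +-monoʳ-≤ (4 * ℓ) (≤-trans (m≤m+n 18 62) (*-monoʳ-≤ 20 4≤ℓ)) ⟩
    4 * ℓ + 20 * ℓ  ≡⟨ *-distribʳ-+ ℓ 4 20 ⟨
    24 * ℓ          ∎))
    where open ≤-Reasoning
  -- Rounding down gives m ℓ ≤ m d ≤ N, as `family` requires, and N ≤ (m + 1) d, which is m ≥ N/d -
  -- 1 without division. By `d≤` the same m satisfies the bound with 24ℓ - 18.
  m = N / d
  mℓ≤N : m * ℓ ≤ N
  mℓ≤N = ≤-trans (*-monoʳ-≤ m ℓ≤d) (m/n*n≤m N d)
  N≤ : N ≤ suc m * d
  N≤ = ≤-trans (≤-reflexive (m≡m%n+[m/n]*n N d)) (+-monoˡ-≤ (m * d) (m%n≤n N d))
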